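{- Let $\beta\in \mathrm{Sym}_n(\mathbb Q)$ be positive semi-definite of rank $n-1$, $\ell_j$ a cusp, and $U_{ij}$ one of the finitely many $n$-dimensional subspaces of the form $\mathrm{span}(X)$, $X\in\Omega_{\beta,j}\cap(L^n+h)$. The action of $\Gamma_j$ on $\Omega_{\beta,j}$ induces a free action of $\Gamma_{U_{ij}}\backslash\Gamma_j$ on $\Omega_{\beta,i,j}$, where $\Gamma_{U_{ij}}=N_{U_{ij}}\cap\Gamma_j$ is the subgroup of $\Gamma_j$ acting trivially on $U_{ij}$.
   Context: $V$ is a $\mathbb Q$-vector space of dimension $p+1$ with a non-degenerate symmetric bilinear form $(\,,)$ of signature $(p,1)$; $L\subset V$ is a $\mathbb Z$-lattice of full rank with $L\subset L^{\#}$ (dual lattice); $1\le n\le p$, $h\in(L^{\#})^n$. $G_0(\mathbb R)$ is the identity component of $SO(V)(\mathbb R)$ and $\Gamma$ is a neat subgroup of finite index in the stabilizer of $L$ in $G_0(\mathbb R)$, acting trivially on $L^{\#}/L$; $V$ has nonzero rational isotropic vectors. $\ell_0,\dots,\ell_r$ represent the $\Gamma$-orbits of rational isotropic lines. $N_j$ is the unipotent radical of the parabolic subgroup stabilizing $\ell_j$; it fixes $\ell_j$ pointwise and acts trivially on $\ell_j^\perp/\ell_j$; $\Gamma_j=\Gamma\cap N_j$, and for $U\subset\ell_j^\perp$, $N_U=\{g\in N_j:g|_U=\mathrm{id}\}$. For $X\in V^n$, $(X,X)=((x_i,x_j))$, and $R(X)$ is the radical of $\mathrm{span}(X)$. $\Omega_{\beta,j}=\{X\in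 V^n:\frac12(X,X)=\beta,\ R(X)=\ell_j\}$ and $\Omega_{\beta,i,j}=\{X\in\Omega_{\beta,j}:\mathrm{span}(X)=U_{ij}\}$. -}

module Defs where

open import Algebra.Bundles using (Group; RawRing)
open import Algebra.Definitions.RawMonoid using (sum)
open import Algebra.Definitions.RawSemiring using (_^_)
open import Algebra.Module.Bundles using (LeftModule)
open import Algebra.Module.Bundles.Raw using (RawLeftModule)
open import Algebra.Module.Morphism.Structures using (module LeftModuleMorphisms)
import Algebra.Module.Morphism.Construct.Composition as Compose
import Algebra.Module.Morphism.Construct.Identity as Identity
import Algebra.Properties.Group as GroupProperties
open import Data.Fin.Base using (Fin; inject₁; fromℕ)
open import Data.Integer.Base using (ℤ)
open import Data.Nat.Base as ℕ using (ℕ; zero; suc)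
import Data.Nat.Properties as ℕ
open import Data.Product.Base using (Σ; Σ-syntax; ∃; ∃-syntax; _×_; _,_; proj₁; proj₂)
open import Data.Rational.Base as ℚ using (ℚ; 0ℚ; 1ℚ; ½; ∣_∣)
import Data.Rational.Properties as ℚ
import Data.Rational.Solver as ℚ-Solver
open import Data.Sum.Base using (_⊎_)
open import Data.Vec.Functional using (Vector; updateAt)
open import Function.Base using (_∘_; const)
open import Level using (Level; 0ℓ; _⊔_) renaming (suc to lsuc)
open import Relation.Binary.Bundles using (Setoid)
open import Relation.Binary.PropositionalEquality.Core using (_≡_; _≢_; refl; sym; trans; cong; subst)
import Relation.Binary.Reasoning.Setoid as SetoidReasoning
open import Relation.Nullary.Negation.Core using (¬_)
open import Relation.Unary using (Pred; _⊆_; _≐_; _∩_; _≬_)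

private
  variable
    a b c ℓ h k : Level

-- Reals are Cauchy sequences of rationals, taken up to the setoid equality _≈ᴿ_.
IsCauchy : (ℕ → ℚ) → Set
IsCauchy s = ∀ ε → 0ℚ ℚ.< ε →
  ∃[ N ] ∀ m n → N ℕ.≤ m → N ℕ.≤ n → ∣ s m ℚ.- s n ∣ ℚ.< ε

record ℝ : Set where
  constructor mkℝ
  field
    seq      : ℕ → ℚ
    isCauchy : IsCauchy seq

open ℝ

infix 4 _≈ᴿ_ _<ᴿ_

_≈ᴿ_ : ℝ → ℝ → Set
x ≈ᴿ y = ∀ ε → 0ℚ ℚ.< ε → ∃[ N ] ∀ n → N ℕ.≤ n → ∣ seq x n ℚ.- seq y n ∣ ℚ.< ε

_<ᴿ_ : ℝ → ℝ → Set
x <ᴿ y = ∃[ ε ] 0ℚ ℚ.< ε × ∃[ N ] ∀ n → N ℕ.≤ n → seq x n ℚ.+ ε ℚ.< seq y n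

private
  halve : ∀ {ε} → 0ℚ ℚ.< ε → 0ℚ ℚ.< ½ ℚ.* ε
  halve {ε} 0<ε = subst (ℚ._< ½ ℚ.* ε) (ℚ.*-zeroʳ ½) (ℚ.*-monoʳ-<-pos ½ 0<ε)

  halves : ∀ ε → ½ ℚ.* ε ℚ.+ ½ ℚ.* ε ≡ ε
  halves ε = trans (sym (ℚ.*-distribʳ-+ ε ½ ½)) (ℚ.*-identityˡ ε)

  ≤⊔ˡ : ∀ {m n k} → m ℕ.⊔ n ℕ.≤ k → m ℕ.≤ k
  ≤⊔ˡ {m} {n} = ℕ.≤-trans (ℕ.m≤m⊔n m n)

  ≤⊔ʳ : ∀ {m n k} → m ℕ.⊔ n ℕ.≤ k → n ℕ.≤ k
  ≤⊔ʳ {m} {n} = ℕ.≤-trans (ℕ.m≤n⊔m m n)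

  split-+ : ∀ a b c d → (a ℚ.+ b) ℚ.- (c ℚ.+ d) ≡ (a ℚ.- c) ℚ.+ (b ℚ.- d)
  split-+ = solve 4 (λ a b c d → (a :+ b) :- (c :+ d) := (a :- c) :+ (b :- d)) refl
    where open ℚ-Solver.+-*-Solver

  split-* : ∀ a b c d → (a ℚ.* b) ℚ.- (c ℚ.* d) ≡ a ℚ.* (b ℚ.- d) ℚ.+ d ℚ.* (a ℚ.- c)
  split-* = solve 4 (λ a b c d → (a :* b) :- (c :* d) := a :* (b :- d) :+ d :* (a :- c)) refl
    where open ℚ-Solver.+-*-Solver

  split-- : ∀ a c → (ℚ.- a) ℚ.- (ℚ.- c) ≡ ℚ.- (a ℚ.- c)
  split-- = solve 2 (λ a c → (:- a) :- (:- c) := :- (a :- c)) refl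
    where open ℚ-Solver.+-*-Solver

  split-0 : ∀ a c → a ≡ (a ℚ.- c) ℚ.+ c
  split-0 = solve 2 (λ a c → a := (a :- c) :+ c) refl
    where open ℚ-Solver.+-*-Solver

  +-cauchy : ∀ {s t} → IsCauchy s → IsCauchy t → IsCauchy (λ n → s n ℚ.+ t n)
  +-cauchy {s} {t} cs ct ε 0<ε =
    let (M , p) = cs _ (halve 0<ε)
        (N , q) = ct _ (halve 0<ε)
    in M ℕ.⊔ N , λ m n M⊔N≤m M⊔N≤n →
      subst (ℚ._< ε) (cong ∣_∣ (sym (split-+ (s m) (t m) (s n) (t n))))
        (ℚ.≤-<-trans (ℚ.∣p+q∣≤∣p∣+∣q∣ (s m ℚ.- s n) (t m ℚ.- t n))
          (subst (_ ℚ.<_) (halves ε)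
            (ℚ.+-mono-< (p m n (≤⊔ˡ M⊔N≤m) (≤⊔ˡ M⊔N≤n)) (q m n (≤⊔ʳ M⊔N≤m) (≤⊔ʳ M⊔N≤n)))))

  neg-cauchy : ∀ {s} → IsCauchy s → IsCauchy (λ n → ℚ.- s n)
  neg-cauchy {s} cs ε 0<ε =
    let (N , p) = cs ε 0<ε
    in N , λ m n N≤m N≤n →
      subst (ℚ._< ε)
        (sym (trans (cong ∣_∣ (split-- (s m) (s n))) (ℚ.∣-p∣≡∣p∣ (s m ℚ.- s n))))
        (p m n N≤m N≤n)

  bounded : ∀ {s} → IsCauchy s → ∃[ B ] ∃[ N ] ∀ n → N ℕ.≤ n → ∣ s n ∣ ℚ.≤ B
  bounded {s} cs =
    let (N , p) = cs 1ℚ (ℚ.positive⁻¹ 1ℚ)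
    in 1ℚ ℚ.+ ∣ s N ∣ , N , λ n N≤n →
      subst (ℚ._≤ _) (cong ∣_∣ (sym (split-0 (s n) (s N))))
        (ℚ.≤-trans (ℚ.∣p+q∣≤∣p∣+∣q∣ (s n ℚ.- s N) (s N))
          (ℚ.+-monoˡ-≤ ∣ s N ∣ (ℚ.<⇒≤ (p n N N≤n ℕ.≤-refl))))

  boundedPos : ∀ {s} → IsCauchy s →
               ∃[ B ] ℚ.Positive B × ∃[ N ] ∀ n → N ℕ.≤ n → ∣ s n ∣ ℚ.≤ B
  boundedPos {s} cs =
    let (B , N , p) = bounded cs
        0≤B = ℚ.≤-trans (ℚ.0≤∣p∣ (s N)) (p N ℕ.≤-refl)
    in B ℚ.+ 1ℚ
     , ℚ.positive (ℚ.+-mono-≤-< 0≤B (ℚ.positive⁻¹ 1ℚ))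
     , N
     , λ n N≤n → ℚ.≤-trans (p n N≤n)
         (subst (ℚ._≤ B ℚ.+ 1ℚ) (ℚ.+-identityʳ B) (ℚ.+-monoʳ-≤ B (ℚ.<⇒≤ (ℚ.positive⁻¹ 1ℚ))))

  scaled : ∀ B → .{{ℚ.Positive B}} → ∀ ε → 0ℚ ℚ.< ε →
           ∃[ δ ] 0ℚ ℚ.< δ × (∀ x y → ∣ x ∣ ℚ.≤ B → ∣ y ∣ ℚ.< δ → ∣ x ℚ.* y ∣ ℚ.< ε)
  scaled B ε 0<ε = δ , 0<δ , λ x y x≤B y<δ →
    subst (ℚ._< ε) (sym (ℚ.∣p*q∣≡∣p∣*∣q∣ x y))
      (ℚ.≤-<-trans (ℚ.*-monoʳ-≤-nonNeg ∣ y ∣ {{ℚ.∣-∣-nonNeg y}} x≤B)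
        (subst (B ℚ.* ∣ y ∣ ℚ.<_) Bδ≡ε (ℚ.*-monoʳ-<-pos B y<δ)))
    where
    instance
      B≢0 : ℚ.NonZero B
      B≢0 = ℚ.pos⇒nonZero B
    B⁻¹ = ℚ.1/ B
    δ = B⁻¹ ℚ.* ε
    0<δ : 0ℚ ℚ.< δ
    0<δ = subst (ℚ._< δ) (ℚ.*-zeroʳ B⁻¹) (ℚ.*-monoʳ-<-pos B⁻¹ {{ℚ.1/pos⇒pos B}} 0<ε)
    Bδ≡ε : B ℚ.* δ ≡ ε
    Bδ≡ε = trans (sym (ℚ.*-assoc B B⁻¹ ε))
             (trans (cong (ℚ._* ε) (ℚ.*-inverseʳ B)) (ℚ.*-identityˡ ε))

  *-cauchy : ∀ {s t} → IsCauchy s → IsCauchy t → IsCauchy (λ n → s n ℚ.* t n)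
  *-cauchy {s} {t} cs ct ε 0<ε =
    let (A , A>0 , K , s≤A)   = boundedPos cs
        (B , B>0 , L , t≤B)   = boundedPos ct
        (δ , 0<δ , small-s)   = scaled A {{A>0}} _ (halve 0<ε)
        (η , 0<η , small-t)   = scaled B {{B>0}} _ (halve 0<ε)
        (M , p) = cs η 0<η
        (N , q) = ct δ 0<δ
    in (K ℕ.⊔ L) ℕ.⊔ (M ℕ.⊔ N) , λ m n H≤m H≤n →
      subst (ℚ._< ε) (cong ∣_∣ (sym (split-* (s m) (t m) (s n) (t n))))
        (ℚ.≤-<-trans (ℚ.∣p+q∣≤∣p∣+∣q∣ (s m ℚ.* (t m ℚ.- t n)) (t n ℚ.* (s m ℚ.- s n)))
          (subst (_ ℚ.<_) (halves ε)
            (ℚ.+-mono-<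
              (small-s (s m) (t m ℚ.- t n) (s≤A m (≤⊔ˡ {K} {L} (≤⊔ˡ H≤m)))
                (q m n (≤⊔ʳ {M} {N} (≤⊔ʳ {K ℕ.⊔ L} H≤m)) (≤⊔ʳ {M} {N} (≤⊔ʳ {K ℕ.⊔ L} H≤n))))
              (small-t (t n) (s m ℚ.- s n) (t≤B n (≤⊔ʳ {K} {L} (≤⊔ˡ H≤n)))
                (p m n (≤⊔ˡ {M} {N} (≤⊔ʳ {K ℕ.⊔ L} H≤m)) (≤⊔ˡ {M} {N} (≤⊔ʳ {K ℕ.⊔ L} H≤n)))))))

  const-cauchy : ∀ q → IsCauchy (const q)
  const-cauchy q ε 0<ε =
    0 , λ _ _ _ _ → subst (ℚ._< ε) (cong ∣_∣ (sym (ℚ.+-inverseʳ q))) 0<ε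

fromℚ : ℚ → ℝ
fromℚ q = mkℝ (const q) (const-cauchy q)

ℝ-rawRing : RawRing 0ℓ 0ℓ
ℝ-rawRing = record
  { Carrier = ℝ
  ; _≈_ = _≈ᴿ_
  ; _+_ = λ x y → mkℝ (λ n → seq x n ℚ.+ seq y n) (+-cauchy {seq x} {seq y} (isCauchy x) (isCauchy y))
  ; _*_ = λ x y → mkℝ (λ n → seq x n ℚ.* seq y n) (*-cauchy {seq x} {seq y} (isCauchy x) (isCauchy y))
  ; -_ = λ x → mkℝ (λ n → ℚ.- seq x n) (neg-cauchy {seq x} (isCauchy x))
  ; 0# = fromℚ 0ℚ
  ; 1# = fromℚ 1ℚ
  }

record ℂ : Set where
  constructor _+i_
  field
    re im : ℝ

ℂ-rawRing : RawRing 0ℓ 0ℓ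
ℂ-rawRing = record
  { Carrier = ℂ
  ; _≈_ = λ { (x +i y) (x′ +i y′) → x ≈ᴿ x′ × y ≈ᴿ y′ }
  ; _+_ = λ { (x +i y) (x′ +i y′) → (x R.+ x′) +i (y R.+ y′) }
  ; _*_ = λ { (x +i y) (x′ +i y′) →
      ((x R.* x′) R.+ (R.- (y R.* y′))) +i ((x R.* y′) R.+ (y R.* x′)) }
  ; -_ = λ { (x +i y) → (R.- x) +i (R.- y) }
  ; 0# = R.0# +i R.0#
  ; 1# = R.1# +i R.0#
  }
  where module R = RawRing ℝ-rawRing

ℚ→ℂ : ℚ → ℂ
ℚ→ℂ q = fromℚ q +i fromℚ 0ℚ

private
  module C = RawRing ℂ-rawRing

-- The subgroup of ℂˣ generated by S; S is only ever a set of invertible numbers.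
data ⟨_⟩ (S : Pred ℂ ℓ) : Pred ℂ ℓ where
  gen   : ∀ {z} → S z → ⟨ S ⟩ z
  one   : ⟨ S ⟩ C.1#
  mul   : ∀ {z w} → ⟨ S ⟩ z → ⟨ S ⟩ w → ⟨ S ⟩ (z C.* w)
  recip : ∀ {z w} → ⟨ S ⟩ z → z C.* w C.≈ C.1# → ⟨ S ⟩ w

TorsionFree : Pred ℂ ℓ → Set ℓ
TorsionFree H = ∀ z → H z → ∀ m → _^_ C.rawSemiring z (suc m) C.≈ C.1# → z C.≈ C.1#

Mat : Set a → ℕ → Set a
Mat A n = Fin n → Fin n → A

module Matrices (K : RawRing a ℓ) where
  open RawRing K

  ∑ : ∀ {n} → Vector Carrier n → Carrier
  ∑ = sum +-rawMonoid

  mulVec : ∀ {n} → Mat Carrier n → Vector Carrier n → Vector Carrier n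
  mulVec A x i = ∑ λ k → A i k * x k

  bilin : ∀ {n} → Mat Carrier n → Vector Carrier n → Vector Carrier n → Carrier
  bilin A x y = ∑ λ i → ∑ λ k → (x i * A i k) * y k

  Kⁿ : ℕ → RawLeftModule Carrier a ℓ
  Kⁿ n = record
    { Carrierᴹ = Vector Carrier n
    ; _≈ᴹ_ = λ x y → ∀ i → x i ≈ y i
    ; _+ᴹ_ = λ x y i → x i + y i
    ; _*ₗ_ = λ c x i → c * x i
    ; 0ᴹ = λ _ → 0#
    ; -ᴹ_ = λ x i → - x i
    }

  IsEigenvalue : ∀ {n} → Mat Carrier n → Pred Carrier (a ⊔ ℓ)
  IsEigenvalue A μ = ∃[ v ] ¬ (∀ i → v i ≈ 0#) × (∀ i → mulVec A v i ≈ μ * v i)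

module Determinant (K : RawRing a ℓ) (M : RawLeftModule (RawRing.Carrier K) b c) where
  open RawRing K
  open RawLeftModule M

  record IsAlternatingForm {d} (ω : Vector Carrierᴹ d → Carrier) : Set (a ⊔ ℓ ⊔ b ⊔ c) where
    field
      ω-cong      : ∀ {v w} → (∀ i → v i ≈ᴹ w i) → ω v ≈ ω w
      additive    : ∀ v i x y → ω (updateAt v i (const (x +ᴹ y))) ≈
                                ω (updateAt v i (const x)) + ω (updateAt v i (const y))
      homogeneous : ∀ v i r x → ω (updateAt v i (const (r *ₗ x))) ≈
                                r * ω (updateAt v i (const x))
      alternating : ∀ v i j → i ≢ j → v i ≈ᴹ v j → ω v ≈ 0#

  -- For M of dimension d, the endomorphism f acts on the (one-dimensional) space of
  -- alternating d-linear forms as multiplication by det f.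
  HasDet : (d : ℕ) → (Carrierᴹ → Carrierᴹ) → Carrier → Set (a ⊔ ℓ ⊔ b ⊔ c)
  HasDet d f D = ∀ (ω : Vector Carrierᴹ d → Carrier) → IsAlternatingForm ω →
                 ∀ v → ω (f ∘ v) ≈ D * ω v

Close : ∀ {d} → ℚ → Mat ℝ d → Mat ℝ d → Set
Close ε A B = ∀ i k → (A i k R.+ (R.- B i k)) <ᴿ fromℚ ε × (B i k R.+ (R.- A i k)) <ᴿ fromℚ ε
  where module R = RawRing ℝ-rawRing

-- Open for the entrywise topology on M_d(ℝ); such a U automatically respects _≈ᴿ_.
IsOpen : ∀ {d} → Pred (Mat ℝ d) 0ℓ → Set
IsOpen U = ∀ A → U A → ∃[ ε ] 0ℚ ℚ.< ε × (∀ B → Close ε A B → U B)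

IsConnected : ∀ {d} → Pred (Mat ℝ d) 0ℓ → Set₁
IsConnected {d} S = ∀ (U W : Pred (Mat ℝ d) 0ℓ) → IsOpen U → IsOpen W →
  (∀ A → S A → U A ⊎ W A) → S ≬ U → S ≬ W → S ≬ (U ∩ W)

Component : ∀ {d} → Pred (Mat ℝ d) 0ℓ → Mat ℝ d → Pred (Mat ℝ d) (lsuc 0ℓ)
Component {d} G A B =
  Σ[ S ∈ Pred (Mat ℝ d) 0ℓ ] S ⊆ G × IsConnected S × S A × S B

module _ (G : Group c ℓ) where
  open Group G
  open GroupProperties G using (⁻¹-anti-homo-∙; ⁻¹-involutive)

  record IsSubgroup (H : Pred Carrier h) : Set (c ⊔ ℓ ⊔ h) where
    field
      resp      : ∀ {x y} → x ≈ y → H x → H y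
      ε-closed  : H ε
      ∙-closed  : ∀ {x y} → H x → H y → H (x ∙ y)
      ⁻¹-closed : ∀ {x} → H x → H (x ⁻¹)

  record IsNormalSubgroupOf (H : Pred Carrier h) (K : Pred Carrier k) : Set (c ⊔ ℓ ⊔ h ⊔ k) where
    field
      isSubgroup : IsSubgroup H
      H⊆K        : H ⊆ K
      conjugate  : ∀ {x y} → K x → H y → H (x ∙ y ∙ x ⁻¹)

  record IsFiniteIndexIn (H : Pred Carrier h) (K : Pred Carrier k) : Set (c ⊔ ℓ ⊔ h ⊔ k) where
    field
      H⊆K   : H ⊆ K
      index : ℕ
      reps  : Vector Carrier index
      reps∈ : ∀ i → K (reps i)
      cover : ∀ x → K x → ∃[ i ] H (reps i ⁻¹ ∙ x)

  subgroup : (K : Pred Carrier k) → IsSubgroup K → Group (c ⊔ k) ℓ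
  subgroup K K≤G = record
    { Carrier = Σ Carrier K
    ; _≈_ = λ x y → proj₁ x ≈ proj₁ y
    ; _∙_ = λ (x , x∈K) (y , y∈K) → x ∙ y , ∙-closed x∈K y∈K
    ; ε = ε , ε-closed
    ; _⁻¹ = λ (x , x∈K) → x ⁻¹ , ⁻¹-closed x∈K
    ; isGroup = record
      { isMonoid = record
        { isSemigroup = record
          { isMagma = record
            { isEquivalence = record
              { refl = Group.refl G ; sym = Group.sym G ; trans = Group.trans G }
            ; ∙-cong = ∙-cong }
          ; assoc = λ x y z → assoc (proj₁ x) (proj₁ y) (proj₁ z) }
        ; identity = (λ x → identityˡ (proj₁ x)) , (λ x → identityʳ (proj₁ x)) }
      ; inverse = (λ x → inverseˡ (proj₁ x)) , (λ x → inverseʳ (proj₁ x))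
      ; ⁻¹-cong = ⁻¹-cong }
    }
    where open IsSubgroup K≤G

  -- H\K: two elements x, y of K are identified when Hx = Hy.
  quotient : (K : Pred Carrier k) → IsSubgroup K →
             (H : Pred Carrier h) → IsNormalSubgroupOf H K → Group (c ⊔ k) h
  quotient K K≤G H H◁K = record
    { Carrier = Σ Carrier K
    ; _≈_ = λ x y → H (proj₁ x ∙ proj₁ y ⁻¹)
    ; _∙_ = Group._∙_ Kᴳ
    ; ε = Group.ε Kᴳ
    ; _⁻¹ = Group._⁻¹ Kᴳ
    ; isGroup = record
      { isMonoid = record
        { isSemigroup = record
          { isMagma = record
            { isEquivalence = record
              { refl = λ {x} → ≈⇒~ {x} {x} (Group.refl G)
              ; sym = λ {x} {y} → ~-sym {proj₁ x} {proj₁ y}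
              ; trans = λ {x} {y} {z} p q → resp (tele (proj₁ x) (proj₁ y) (proj₁ z)) (∙-closed p q) }
            ; ∙-cong = λ {x} {y} {u} {v} p q →
                resp (prod (proj₁ x) (proj₁ y) (proj₁ u) (proj₁ v))
                  (∙-closed (conjugate (proj₂ x) q) p) }
          ; assoc = λ x y z → ≈⇒~ {(x K∙ y) K∙ z} {x K∙ (y K∙ z)} (Group.assoc Kᴳ x y z) }
        ; identity = (λ x → ≈⇒~ {Group.ε Kᴳ K∙ x} {x} (Group.identityˡ Kᴳ x))
                   , (λ x → ≈⇒~ {x K∙ Group.ε Kᴳ} {x} (Group.identityʳ Kᴳ x)) }
      ; inverse = (λ x → ≈⇒~ {(Group._⁻¹ Kᴳ x) K∙ x} {Group.ε Kᴳ} (Group.inverseˡ Kᴳ x))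
                , (λ x → ≈⇒~ {x K∙ (Group._⁻¹ Kᴳ x)} {Group.ε Kᴳ} (Group.inverseʳ Kᴳ x))
      ; ⁻¹-cong = λ {x} {y} p →
          resp (flip (proj₁ x) (proj₁ y))
            (conjugate (IsSubgroup.⁻¹-closed K≤G (proj₂ x)) (~-sym {proj₁ x} {proj₁ y} p)) }
    }
    where
    open IsNormalSubgroupOf H◁K
    open IsSubgroup isSubgroup
    open SetoidReasoning setoid
    Kᴳ = subgroup K K≤G
    _K∙_ = Group._∙_ Kᴳ

    ≈⇒~ : ∀ {x y : Σ Carrier K} → proj₁ x ≈ proj₁ y → H (proj₁ x ∙ proj₁ y ⁻¹)
    ≈⇒~ {x} {y} x≈y = resp
      (Group.sym G (Group.trans G (∙-congʳ x≈y) (inverseʳ (proj₁ y)))) ε-closed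

    ~-sym : ∀ {x y} → H (x ∙ y ⁻¹) → H (y ∙ x ⁻¹)
    ~-sym {x} {y} p = resp
      (Group.trans G (⁻¹-anti-homo-∙ x (y ⁻¹)) (∙-congʳ (⁻¹-involutive y))) (⁻¹-closed p)

    tele : ∀ x y z → (x ∙ y ⁻¹) ∙ (y ∙ z ⁻¹) ≈ x ∙ z ⁻¹
    tele x y z = begin
      (x ∙ y ⁻¹) ∙ (y ∙ z ⁻¹)  ≈⟨ assoc x (y ⁻¹) (y ∙ z ⁻¹) ⟩
      x ∙ (y ⁻¹ ∙ (y ∙ z ⁻¹))  ≈⟨ ∙-congˡ (assoc (y ⁻¹) y (z ⁻¹)) ⟨
      x ∙ ((y ⁻¹ ∙ y) ∙ z ⁻¹)  ≈⟨ ∙-congˡ (∙-congʳ (inverseˡ y)) ⟩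
      x ∙ (ε ∙ z ⁻¹)           ≈⟨ ∙-congˡ (identityˡ (z ⁻¹)) ⟩
      x ∙ z ⁻¹                 ∎

    prod : ∀ x y u v → (x ∙ (u ∙ v ⁻¹) ∙ x ⁻¹) ∙ (x ∙ y ⁻¹) ≈ (x ∙ u) ∙ (y ∙ v) ⁻¹
    prod x y u v = begin
      (x ∙ (u ∙ v ⁻¹) ∙ x ⁻¹) ∙ (x ∙ y ⁻¹)  ≈⟨ tele (x ∙ (u ∙ v ⁻¹)) x y ⟩
      (x ∙ (u ∙ v ⁻¹)) ∙ y ⁻¹               ≈⟨ ∙-congʳ (assoc x u (v ⁻¹)) ⟨
      ((x ∙ u) ∙ v ⁻¹) ∙ y ⁻¹               ≈⟨ assoc (x ∙ u) (v ⁻¹) (y ⁻¹) ⟩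
      (x ∙ u) ∙ (v ⁻¹ ∙ y ⁻¹)               ≈⟨ ∙-congˡ (⁻¹-anti-homo-∙ y v) ⟨
      (x ∙ u) ∙ (y ∙ v) ⁻¹                  ∎

    flip : ∀ x y → x ⁻¹ ∙ (y ∙ x ⁻¹) ∙ x ⁻¹ ⁻¹ ≈ x ⁻¹ ∙ y ⁻¹ ⁻¹
    flip x y = begin
      x ⁻¹ ∙ (y ∙ x ⁻¹) ∙ x ⁻¹ ⁻¹    ≈⟨ assoc (x ⁻¹) (y ∙ x ⁻¹) (x ⁻¹ ⁻¹) ⟩
      x ⁻¹ ∙ ((y ∙ x ⁻¹) ∙ x ⁻¹ ⁻¹)  ≈⟨ ∙-congˡ (assoc y (x ⁻¹) (x ⁻¹ ⁻¹)) ⟩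
      x ⁻¹ ∙ (y ∙ (x ⁻¹ ∙ x ⁻¹ ⁻¹))  ≈⟨ ∙-congˡ (∙-congˡ (inverseʳ (x ⁻¹))) ⟩
      x ⁻¹ ∙ (y ∙ ε)                 ≈⟨ ∙-congˡ (identityʳ y) ⟩
      x ⁻¹ ∙ y                       ≈⟨ ∙-congˡ (⁻¹-involutive y) ⟨
      x ⁻¹ ∙ y ⁻¹ ⁻¹                 ∎

record Action (G : Group c ℓ) (X : Setoid a b) : Set (a ⊔ b ⊔ c ⊔ ℓ) where
  private
    module G = Group G
    module X = Setoid X
  infixr 5 _▷_
  field
    _▷_    : G.Carrier → X.Carrier → X.Carrier
    ▷-cong : ∀ {g g′ x x′} → g G.≈ g′ → x X.≈ x′ → g ▷ x X.≈ g′ ▷ x′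
    ▷-ε    : ∀ x → G.ε ▷ x X.≈ x
    ▷-∙    : ∀ g g′ x → (g G.∙ g′) ▷ x X.≈ g ▷ g′ ▷ x

  IsFree : Set (a ⊔ b ⊔ c ⊔ ℓ)
  IsFree = ∀ g x → g ▷ x X.≈ x → g G.≈ G.ε

ℚ-VectorSpace : Set₁
ℚ-VectorSpace = LeftModule ℚ.+-*-ring 0ℓ 0ℓ

module LinearAlgebra (V : ℚ-VectorSpace) where
  open LeftModule V
  open LeftModuleMorphisms rawLeftModule rawLeftModule

  lin : ∀ {n} → Vector ℚ n → Vector Carrierᴹ n → Carrierᴹ
  lin c v = sum +ᴹ-rawMonoid λ i → c i *ₗ v i

  Span : ∀ {n} → Vector Carrierᴹ n → Pred Carrierᴹ 0ℓ
  Span v w = ∃[ c ] w ≈ᴹ lin c v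

  ℤ-Span : ∀ {n} → Vector Carrierᴹ n → Pred Carrierᴹ 0ℓ
  ℤ-Span {n} v w = Σ[ z ∈ Vector ℤ n ] w ≈ᴹ lin (λ i → z i ℚ./ 1) v

  Independent : ∀ {n} → Vector Carrierᴹ n → Set
  Independent v = ∀ c → lin c v ≈ᴹ 0ᴹ → ∀ i → c i ≡ 0ℚ

  HasDimension : Pred Carrierᴹ 0ℓ → ℕ → Set
  HasDimension U n = Σ[ v ∈ Vector Carrierᴹ n ] Independent v × U ≐ Span v

  record IsBasis {n} (v : Vector Carrierᴹ n) : Set where
    field
      independent : Independent v
      spanning    : ∀ w → Span v w

    coordinates : Carrierᴹ → Vector ℚ n
    coordinates w = proj₁ (spanning w)

  IsFullLattice : Pred Carrierᴹ 0ℓ → Set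
  IsFullLattice L = ∃[ n ] Σ[ v ∈ Vector Carrierᴹ n ] IsBasis v × L ≐ ℤ-Span v

  record GL : Set where
    constructor mkGL
    field
      ⟦_⟧   : Carrierᴹ → Carrierᴹ
      isIso : IsLeftModuleIsomorphism ⟦_⟧

    open IsLeftModuleIsomorphism isIso public

    inv : Carrierᴹ → Carrierᴹ
    inv w = proj₁ (surjective w)

    inv-section : ∀ w → ⟦ inv w ⟧ ≈ᴹ w
    inv-section w = proj₂ (surjective w) ≈ᴹ-refl

    inv-unique : ∀ {v w} → ⟦ v ⟧ ≈ᴹ w → inv w ≈ᴹ v
    inv-unique {v} {w} p = injective (≈ᴹ-trans (inv-section w) (≈ᴹ-sym p))

    inv-cong : ∀ {v w} → v ≈ᴹ w → inv v ≈ᴹ inv w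
    inv-cong {v} {w} p = inv-unique (≈ᴹ-trans (inv-section w) (≈ᴹ-sym p))

  open GL using (⟦_⟧)

  private
    invIso : (g : GL) → IsLeftModuleIsomorphism (GL.inv g)
    invIso g = record
      { isLeftModuleMonomorphism = record
        { isLeftModuleHomomorphism = record
          { +ᴹ-isGroupHomomorphism = record
            { isMonoidHomomorphism = record
              { isMagmaHomomorphism = record
                { isRelHomomorphism = record { cong = inv-cong }
                ; homo = λ v w → inv-unique
                    (≈ᴹ-trans (+ᴹ-homo (inv v) (inv w)) (+ᴹ-cong (inv-section v) (inv-section w))) }
              ; ε-homo = inv-unique 0ᴹ-homo }
            ; ⁻¹-homo = λ v → inv-unique (≈ᴹ-trans (-ᴹ-homo (inv v)) (-ᴹ‿cong (inv-section v))) }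
          ; *ₗ-homo = λ r v → inv-unique
              (≈ᴹ-trans (*ₗ-homo r (inv v)) (*ₗ-cong refl (inv-section v))) }
        ; injective = λ {v} {w} p → ≈ᴹ-trans (≈ᴹ-sym (inv-section v))
            (≈ᴹ-trans (⟦⟧-cong p) (inv-section w)) }
      ; surjective = λ v → _ , λ p → inv-unique (≈ᴹ-sym p)
      }
      where open GL g hiding (⟦_⟧)

  GLᴳ : Group 0ℓ 0ℓ
  GLᴳ = record
    { Carrier = GL
    ; _≈_ = λ f g → ∀ v → ⟦ f ⟧ v ≈ᴹ ⟦ g ⟧ v
    ; _∙_ = λ f g → mkGL (⟦ f ⟧ ∘ ⟦ g ⟧)
        (Compose.isLeftModuleIsomorphism ≈ᴹ-trans (GL.isIso g) (GL.isIso f))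
    ; ε = mkGL (λ v → v) (Identity.isLeftModuleIsomorphism rawLeftModule ≈ᴹ-refl)
    ; _⁻¹ = λ g → mkGL (GL.inv g) (invIso g)
    ; isGroup = record
      { isMonoid = record
        { isSemigroup = record
          { isMagma = record
            { isEquivalence = record
              { refl = λ v → ≈ᴹ-refl
              ; sym = λ p v → ≈ᴹ-sym (p v)
              ; trans = λ p q v → ≈ᴹ-trans (p v) (q v) }
            ; ∙-cong = λ {f} {g} {u} {w} p q v →
                ≈ᴹ-trans (GL.⟦⟧-cong f (q v)) (p (⟦ w ⟧ v)) }
          ; assoc = λ _ _ _ _ → ≈ᴹ-refl }
        ; identity = (λ _ _ → ≈ᴹ-refl) , (λ _ _ → ≈ᴹ-refl) }
      ; inverse = (λ g v → GL.inv-unique g ≈ᴹ-refl) , (λ g v → GL.inv-section g v)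
      ; ⁻¹-cong = λ {f} {g} p v → GL.inv-unique f (≈ᴹ-trans (p _) (GL.inv-section g v)) }
    }

  Image : GL → Pred Carrierᴹ 0ℓ → Pred Carrierᴹ 0ℓ
  Image g S w = ∃[ v ] S v × w ≈ᴹ ⟦ g ⟧ v

  IsUnipotent : GL → Set
  IsUnipotent g = ∃[ m ] ∀ v → pow m v ≈ᴹ 0ᴹ
    where
    pow : ℕ → Carrierᴹ → Carrierᴹ
    pow zero    v = v
    pow (suc m) v = ⟦ g ⟧ (pow m v) +ᴹ (-ᴹ pow m v)

  -- Rational points of the unipotent radical of the algebraic group whose group of
  -- rational points is P: the union of all normal subgroups of P that consist of unipotent
  -- elements. Connectedness is not imposed since unipotent groups in characteristic zero are
  -- connected, and nothing is lost by working with rational points when these are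
  -- Zariski dense, as for the parabolic subgroups to which this is applied.
  UnipotentRadical : Pred GL 0ℓ → Pred GL (lsuc 0ℓ)
  UnipotentRadical P g = Σ[ H ∈ Pred GL 0ℓ ]
    IsNormalSubgroupOf GLᴳ H P × (∀ {x} → H x → IsUnipotent x) × H g

module _ {n : ℕ} (β : Mat ℚ n) where
  open Matrices ℚ.+-*-rawRing

  IsSymmetric : Set
  IsSymmetric = ∀ i k → β i k ≡ β k i

  IsPositiveSemidefinite : Set
  IsPositiveSemidefinite = ∀ x → 0ℚ ℚ.≤ bilin β x x

  -- Some r columns form a basis of the column space.
  record HasRank (r : ℕ) : Set where
    field
      columns     : Fin r → Fin n
      independent : ∀ (c : Vector ℚ r) → (∀ i → ∑ (λ m → c m ℚ.* β i (columns m)) ≡ 0ℚ) → ∀ m → c m ≡ 0ℚ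
      spanning    : ∀ k → Σ[ c ∈ Vector ℚ r ] ∀ i → β i k ≡ ∑ (λ m → c m ℚ.* β i (columns m))

record QuadraticSpace (p : ℕ) : Set₁ where
  field
    V : ℚ-VectorSpace

  open LeftModule V public
  open LinearAlgebra V public

  field
    basis   : Vector Carrierᴹ (suc p)
    isBasis : IsBasis basis

    ⟪_,_⟫       : Carrierᴹ → Carrierᴹ → ℚ
    ⟪⟫-cong     : ∀ {x x′ y y′} → x ≈ᴹ x′ → y ≈ᴹ y′ → ⟪ x , y ⟫ ≡ ⟪ x′ , y′ ⟫
    ⟪⟫-sym      : ∀ x y → ⟪ x , y ⟫ ≡ ⟪ y , x ⟫
    ⟪⟫-+        : ∀ x x′ y → ⟪ x +ᴹ x′ , y ⟫ ≡ ⟪ x , y ⟫ ℚ.+ ⟪ x′ , y ⟫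
    ⟪⟫-*        : ∀ r x y → ⟪ r *ₗ x , y ⟫ ≡ r ℚ.* ⟪ x , y ⟫
    nondegenerate : ∀ x → (∀ y → ⟪ x , y ⟫ ≡ 0ℚ) → x ≈ᴹ 0ᴹ

    -- signature (p,1): an orthogonal basis with p positive vectors and one negative vector
    orthogonalBasis : Vector Carrierᴹ (suc p)
    isOrthogonalBasis : IsBasis orthogonalBasis
    orthogonal : ∀ i k → i ≢ k → ⟪ orthogonalBasis i , orthogonalBasis k ⟫ ≡ 0ℚ
    positive   : ∀ (i : Fin p) → 0ℚ ℚ.< ⟪ orthogonalBasis (inject₁ i) , orthogonalBasis (inject₁ i) ⟫
    negative   : ⟪ orthogonalBasis (fromℕ p) , orthogonalBasis (fromℕ p) ⟫ ℚ.< 0ℚ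

module Geometry {p : ℕ} (Q : QuadraticSpace p) where
  open QuadraticSpace Q
  open GL using (⟦_⟧)
  private
    module MR = Matrices ℝ-rawRing
    module MC = Matrices ℂ-rawRing

  dim : ℕ
  dim = suc p

  -- SO(V)(ℚ)
  SO : Pred GL 0ℓ
  SO g =
    (∀ x y → ⟪ ⟦ g ⟧ x , ⟦ g ⟧ y ⟫ ≡ ⟪ x , y ⟫) ×
    Determinant.HasDet ℚ.+-*-rawRing rawLeftModule dim ⟦ g ⟧ 1ℚ

  Gramᴿ : Mat ℝ dim
  Gramᴿ i k = fromℚ ⟪ basis i , basis k ⟫

  -- SO(V)(ℝ), as matrices in the coordinates of V ⊗ ℝ given by the basis of V
  SOᴿ : Pred (Mat ℝ dim) 0ℓ
  SOᴿ A =
    (∀ (x y : Vector ℝ dim) →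
       MR.bilin Gramᴿ (MR.mulVec A x) (MR.mulVec A y) ≈ᴿ MR.bilin Gramᴿ x y) ×
    Determinant.HasDet ℝ-rawRing (MR.Kⁿ dim) dim (MR.mulVec A) (fromℚ 1ℚ)

  matrix : GL → Mat ℚ dim
  matrix g i k = IsBasis.coordinates isBasis (⟦ g ⟧ (basis k)) i

  matrixᴿ : GL → Mat ℝ dim
  matrixᴿ g i k = fromℚ (matrix g i k)

  -- The rational elements of G₀(ℝ), the identity component of SO(V)(ℝ).
  G₀ : Pred GL (lsuc 0ℓ)
  G₀ g = Component SOᴿ (matrixᴿ (Group.ε GLᴳ)) (matrixᴿ g)

  Dual : Pred Carrierᴹ 0ℓ → Pred Carrierᴹ 0ℓ
  Dual L x = ∀ y → L y → Σ[ z ∈ ℤ ] ⟪ x , y ⟫ ≡ z ℚ./ 1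

  -- The stabilizer of L in G₀(ℝ); an element of G₀(ℝ) with gL = L is automatically rational
  -- since L spans V.
  Stabilizer : Pred Carrierᴹ 0ℓ → Pred GL (lsuc 0ℓ)
  Stabilizer L g = G₀ g × Image g L ≐ L

  IsNeat : Pred GL ℓ → Set ℓ
  IsNeat Γ = ∀ γ → Γ γ →
    TorsionFree ⟨ MC.IsEigenvalue (λ i k → ℚ→ℂ (matrix γ i k)) ⟩

  ActsTriviallyOnDiscriminant : Pred GL ℓ → Pred Carrierᴹ 0ℓ → Set ℓ
  ActsTriviallyOnDiscriminant Γ L = ∀ γ → Γ γ → ∀ x → Dual L x → L (⟦ γ ⟧ x +ᴹ (-ᴹ x))

  IsIsotropicLine : Pred Carrierᴹ 0ℓ → Set
  IsIsotropicLine l = Σ[ v ∈ Carrierᴹ ] v ≉ᴹ 0ᴹ × ⟪ v , v ⟫ ≡ 0ℚ × l ≐ Span {1} (const v)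

  record RepresentOrbitsOfIsotropicLines (Γ : Pred GL ℓ) {r : ℕ}
                                         (l : Fin (suc r) → Pred Carrierᴹ 0ℓ) : Set (lsuc 0ℓ ⊔ ℓ) where
    field
      isotropic    : ∀ j → IsIsotropicLine (l j)
      complete     : ∀ m → IsIsotropicLine m → ∃[ j ] Σ[ γ ∈ GL ] Γ γ × Image γ m ≐ l j
      inequivalent : ∀ i j γ → Γ γ → Image γ (l i) ≐ l j → i ≡ j

  Parabolic : Pred Carrierᴹ 0ℓ → Pred GL 0ℓ
  Parabolic l g = SO g × Image g l ≐ l

  N : Pred Carrierᴹ 0ℓ → Pred GL (lsuc 0ℓ)
  N l = UnipotentRadical (Parabolic l)

  N[_,_] : Pred Carrierᴹ 0ℓ → Pred Carrierᴹ 0ℓ → Pred GL (lsuc 0ℓ)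
  N[ l , U ] g = N l g × (∀ u → U u → ⟦ g ⟧ u ≈ᴹ u)

  Radical : ∀ {n} → Vector Carrierᴹ n → Pred Carrierᴹ 0ℓ
  Radical X v = Span X v × (∀ w → Span X w → ⟪ v , w ⟫ ≡ 0ℚ)

  Tuples : (n : ℕ) → Pred (Vector Carrierᴹ n) 0ℓ → Setoid 0ℓ 0ℓ
  Tuples n S = record
    { Carrier = Σ (Vector Carrierᴹ n) S
    ; _≈_ = λ X Y → ∀ i → proj₁ X i ≈ᴹ proj₁ Y i
    ; isEquivalence = record
      { refl = λ i → ≈ᴹ-refl
      ; sym = λ p i → ≈ᴹ-sym (p i)
      ; trans = λ p q i → ≈ᴹ-trans (p i) (q i) }
    }

  module _ {n : ℕ} (β : Mat ℚ n) (l : Pred Carrierᴹ 0ℓ) where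

    Ω : Pred (Vector Carrierᴹ n) 0ℓ
    Ω X = (∀ i k → ½ ℚ.* ⟪ X i , X k ⟫ ≡ β i k) × Radical X ≐ l

    Ω[_] : Pred Carrierᴹ 0ℓ → Pred (Vector Carrierᴹ n) 0ℓ
    Ω[ U ] X = Ω X × Span X ≐ U

  _∈_^n+_ : ∀ {n} → Vector Carrierᴹ n → Pred Carrierᴹ 0ℓ → Vector Carrierᴹ n → Set
  X ∈ L ^n+ h = ∀ i → L (X i +ᴹ (-ᴹ h i))

  module _ (Γ : Pred GL ℓ) (l : Pred Carrierᴹ 0ℓ) where

    Γ∩N : Pred GL (lsuc 0ℓ ⊔ ℓ)
    Γ∩N = Γ ∩ N l

    Γ-fixing : Pred Carrierᴹ 0ℓ → Pred GL (lsuc 0ℓ ⊔ ℓ)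
    Γ-fixing U = N[ l , U ] ∩ Γ∩N

    -- X ↦ gX makes Γ_l a group acting on Ω_{β,l}; on Ω_{β,l,U} this restricts to an action
    -- that factors through the quotient group Γ_U\Γ_l, and the resulting action is free.
    record InducesFreeAction {n : ℕ} (β : Mat ℚ n) (U : Pred Carrierᴹ 0ℓ) : Set (lsuc 0ℓ ⊔ ℓ) where
      field
        isSubgroup : IsSubgroup GLᴳ Γ∩N
        isNormal   : IsNormalSubgroupOf GLᴳ (Γ-fixing U) Γ∩N
        action     : Action (subgroup GLᴳ Γ∩N isSubgroup) (Tuples n (Ω β l))
        induced    : Action (quotient GLᴳ Γ∩N isSubgroup (Γ-fixing U) isNormal) (Tuples n (Ω[_] β l U))

      open Action action using (_▷_)
      open Action induced renaming (_▷_ to _▷ᵁ_)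

      field
        action-def : ∀ g X i → proj₁ (g ▷ X) i ≈ᴹ ⟦ proj₁ g ⟧ (proj₁ X i)
        compatible : ∀ g (X : Vector Carrierᴹ n) (X∈ : Ω[_] β l U X) i →
                     proj₁ (g ▷ᵁ (X , X∈)) i ≈ᴹ proj₁ (g ▷ (X , proj₁ X∈)) i
        free       : IsFree

{-# OPTIONS --safe #-}
-- In signature (p,1) every isotropic vector of ℓ^⊥ lies in ℓ, so ℓ^⊥/ℓ is anisotropic and a
-- unipotent isometry stabilizing ℓ fixes ℓ and acts trivially on ℓ^⊥/ℓ. Conversely such isometries
-- satisfy (g − 1)³ = 0 and form a normal subgroup of the parabolic, which is therefore N. If X has
-- radical ℓ then ℓ ⊆ span X ⊆ ℓ^⊥, so N preserves span X; and an element fixing X fixes span X,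
-- i.e. it is trivial in the quotient by the pointwise stabilizer of span X.
module Submission where

open import Defs
open import Algebra.Bundles using (Group)
open import Algebra.Module.Bundles using (LeftModule)
import Algebra.Properties.AbelianGroup as AbelianGroupProperties
import Algebra.Properties.CommutativeMonoid.Sum as CommutativeMonoidSum
open import Data.Fin.Base using (Fin; zero; suc; fromℕ)
import Data.Fin.Properties as Fin
open import Data.Fin.Relation.Unary.Top using (view; ‵fromℕ; ‵inject₁)
open import Data.Nat.Base using (ℕ; zero; suc; pred; _≤_)
open import Data.Product.Base using (Σ-syntax; ∃-syntax; _×_; _,_; proj₁; proj₂)
open import Data.Rational.Base as ℚ using (ℚ; 0ℚ; 1ℚ; ½)
import Data.Rational.Properties as ℚ
import Data.Rational.Solver as ℚ-Solver
open import Data.Sum.Base using (_⊎_; inj₁; inj₂)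
open import Data.Vec.Functional using (Vector; _∷_)
open import Function.Base using (_∘_; const)
open import Level using (0ℓ) renaming (suc to lsuc)
open import Relation.Binary.PropositionalEquality.Core using (_≡_; _≢_; refl; sym; trans; cong; cong₂)
open import Relation.Binary.PropositionalEquality.Properties using (module ≡-Reasoning)
import Relation.Binary.Reasoning.Setoid as SetoidReasoning
open import Relation.Nullary.Decidable.Core using (yes; no)
open import Relation.Nullary.Negation.Core using (contradiction)
open import Relation.Unary using (Pred; _⊆_; _≐_)

-- Rational arithmetic: zero products, squares, sums of non-negative terms.

module ℚ-Sum = CommutativeMonoidSum ℚ.+-0-commutativeMonoid
module ℚ-Group = AbelianGroupProperties ℚ.+-0-abelianGroup

p*q≡0⇒p≡0∨q≡0 : ∀ p q → p ℚ.* q ≡ 0ℚ → p ≡ 0ℚ ⊎ q ≡ 0ℚ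
p*q≡0⇒p≡0∨q≡0 p q pq≡0 with p ℚ.≟ 0ℚ
... | yes p≡0 = inj₁ p≡0
... | no  p≢0 = inj₂ (begin
  q                    ≡⟨ ℚ.*-identityˡ q ⟨
  1ℚ ℚ.* q             ≡⟨ cong (ℚ._* q) (ℚ.*-inverseˡ p) ⟨
  ℚ.1/ p ℚ.* p ℚ.* q   ≡⟨ ℚ.*-assoc (ℚ.1/ p) p q ⟩
  ℚ.1/ p ℚ.* (p ℚ.* q) ≡⟨ cong (ℚ.1/ p ℚ.*_) pq≡0 ⟩
  ℚ.1/ p ℚ.* 0ℚ        ≡⟨ ℚ.*-zeroʳ (ℚ.1/ p) ⟩
  0ℚ                   ∎)
  where
  open ≡-Reasoning
  instance _ = ℚ.≢-nonZero p≢0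

p²≥0 : ∀ p → 0ℚ ℚ.≤ p ℚ.* p
p²≥0 p with ℚ.≤-total 0ℚ p
... | inj₁ 0≤p = ℚ.nonNegative⁻¹ _ {{ℚ.nonNeg*nonNeg⇒nonNeg p {{ℚ.nonNegative 0≤p}} p {{ℚ.nonNegative 0≤p}}}}
... | inj₂ p≤0 = ℚ.nonNegative⁻¹ _ {{ℚ.nonPos*nonPos⇒nonPos p {{ℚ.nonPositive p≤0}} p {{ℚ.nonPositive p≤0}}}}

p+q≡0⇒p≡0 : ∀ {p q} → 0ℚ ℚ.≤ p → 0ℚ ℚ.≤ q → p ℚ.+ q ≡ 0ℚ → p ≡ 0ℚ
p+q≡0⇒p≡0 {p} {q} 0≤p 0≤q p+q≡0 = ℚ.≤-antisym p≤0 0≤p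
  where
  p≤0 : p ℚ.≤ 0ℚ
  p≤0 = ℚ.≤-trans (ℚ.≤-reflexive (sym (ℚ.+-identityʳ p)))
          (ℚ.≤-trans (ℚ.+-monoʳ-≤ p 0≤q) (ℚ.≤-reflexive p+q≡0))

sum-nonNeg : ∀ {n} (t : Vector ℚ n) → (∀ i → 0ℚ ℚ.≤ t i) → 0ℚ ℚ.≤ ℚ-Sum.sum t
sum-nonNeg {zero}  t 0≤t = ℚ.≤-refl
sum-nonNeg {suc n} t 0≤t = ℚ.+-mono-≤ (0≤t zero) (sum-nonNeg (t ∘ suc) (0≤t ∘ suc))

-- Head and tail of the sum are both non-negative, so neither can compensate the other. Applied to
-- the diagonalized form on the positive definite hyperplane.
sum≡0⇒term≡0 : ∀ {n} (t : Vector ℚ n) → (∀ i → 0ℚ ℚ.≤ t i) → ℚ-Sum.sum t ≡ 0ℚ → ∀ i → t i ≡ 0ℚ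
sum≡0⇒term≡0 t 0≤t ∑≡0 zero = p+q≡0⇒p≡0 (0≤t zero) (sum-nonNeg (t ∘ suc) (0≤t ∘ suc)) ∑≡0
sum≡0⇒term≡0 t 0≤t ∑≡0 (suc i) = sum≡0⇒term≡0 (t ∘ suc) (0≤t ∘ suc)
  (p+q≡0⇒p≡0 (sum-nonNeg (t ∘ suc) (0≤t ∘ suc)) (0≤t zero) (trans (ℚ.+-comm _ (t zero)) ∑≡0)) i

sum-zero : ∀ {n} (t : Vector ℚ n) → (∀ i → t i ≡ 0ℚ) → ℚ-Sum.sum t ≡ 0ℚ
sum-zero {n} t t≡0 = trans (ℚ-Sum.sum-cong-≗ t≡0) (ℚ-Sum.sum-replicate-zero n)

sum-single : ∀ {n} (t : Vector ℚ n) i → (∀ k → i ≢ k → t k ≡ 0ℚ) → ℚ-Sum.sum t ≡ t i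
sum-single {suc n} t i t≡0 = trans (ℚ-Sum.sum-remove {i = i} t)
  (trans (cong (t i ℚ.+_) (sum-zero _ λ k → t≡0 _ (Fin.punchInᵢ≢i i k ∘ sym))) (ℚ.+-identityʳ (t i)))

-- Linear algebra over ℚ: spans, lines and the operator g - 1.

module LinearAlgebraProperties (V : ℚ-VectorSpace) where
  open LeftModule V
  open LinearAlgebra V
  open GL using (⟦_⟧)
  open AbelianGroupProperties +ᴹ-abelianGroup
    using (inverseʳ-unique; ⁻¹-anti-homo‿-; x∙y⁻¹≈ε⇒x≈y; //-rightDividesˡ)
  open CommutativeMonoidSum +ᴹ-commutativeMonoid using (∑-distrib-+; sum-cong-≋)
  open SetoidReasoning ≈ᴹ-setoid

  infixl 6 _⊖_

  _⊖_ : Carrierᴹ → Carrierᴹ → Carrierᴹ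
  x ⊖ y = x +ᴹ (-ᴹ y)

  ⊖-cong : ∀ {x x′ y y′} → x ≈ᴹ x′ → y ≈ᴹ y′ → x ⊖ y ≈ᴹ x′ ⊖ y′
  ⊖-cong p q = +ᴹ-cong p (-ᴹ‿cong q)

  ⊖-+ᴹ : ∀ x y → (x ⊖ y) +ᴹ y ≈ᴹ x
  ⊖-+ᴹ x y = //-rightDividesˡ y x

  ⊖-telescope : ∀ x y z → (x ⊖ y) +ᴹ (y ⊖ z) ≈ᴹ x ⊖ z
  ⊖-telescope x y z = begin
    (x ⊖ y) +ᴹ (y ⊖ z)  ≈⟨ +ᴹ-assoc (x ⊖ y) y (-ᴹ z) ⟨
    (x ⊖ y) +ᴹ y ⊖ z    ≈⟨ +ᴹ-congʳ (⊖-+ᴹ x y) ⟩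
    x ⊖ z               ∎

  ⊖-swap : ∀ x y → -ᴹ (x ⊖ y) ≈ᴹ y ⊖ x
  ⊖-swap = ⁻¹-anti-homo‿-

  x⊖y≈0⇒x≈y : ∀ {x y} → x ⊖ y ≈ᴹ 0ᴹ → x ≈ᴹ y
  x⊖y≈0⇒x≈y = x∙y⁻¹≈ε⇒x≈y _ _

  x≈y⇒x⊖y≈0 : ∀ {x y} → x ≈ᴹ y → x ⊖ y ≈ᴹ 0ᴹ
  x≈y⇒x⊖y≈0 {x} {y} x≈y = ≈ᴹ-trans (+ᴹ-congʳ x≈y) (-ᴹ‿inverseʳ y)

  *ₗ-negˡ : ∀ r x → (ℚ.- r) *ₗ x ≈ᴹ -ᴹ (r *ₗ x)
  *ₗ-negˡ r x = inverseʳ-unique (r *ₗ x) ((ℚ.- r) *ₗ x) (begin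
    r *ₗ x +ᴹ (ℚ.- r) *ₗ x  ≈⟨ *ₗ-distribʳ x r (ℚ.- r) ⟨
    (r ℚ.+ (ℚ.- r)) *ₗ x    ≈⟨ *ₗ-congʳ (ℚ.+-inverseʳ r) ⟩
    0ℚ *ₗ x                 ≈⟨ *ₗ-zeroˡ x ⟩
    0ᴹ                      ∎)

  -ᴹ≈-1*ₗ : ∀ x → -ᴹ x ≈ᴹ (ℚ.- 1ℚ) *ₗ x
  -ᴹ≈-1*ₗ x = ≈ᴹ-trans (-ᴹ‿cong (≈ᴹ-sym (*ₗ-identityˡ x))) (≈ᴹ-sym (*ₗ-negˡ 1ℚ x))

  *ₗ-distribˡ-⊖ : ∀ r x y → r *ₗ (x ⊖ y) ≈ᴹ r *ₗ x ⊖ r *ₗ y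
  *ₗ-distribˡ-⊖ r x y = begin
    r *ₗ (x ⊖ y)                   ≈⟨ *ₗ-distribˡ r x (-ᴹ y) ⟩
    r *ₗ x +ᴹ r *ₗ (-ᴹ y)          ≈⟨ +ᴹ-congˡ (*ₗ-congˡ (-ᴹ≈-1*ₗ y)) ⟩
    r *ₗ x +ᴹ r *ₗ (ℚ.- 1ℚ) *ₗ y   ≈⟨ +ᴹ-congˡ (*ₗ-assoc r (ℚ.- 1ℚ) y) ⟨
    r *ₗ x +ᴹ (r ℚ.* (ℚ.- 1ℚ)) *ₗ y ≈⟨ +ᴹ-congˡ (*ₗ-congʳ (ℚ.*-comm r (ℚ.- 1ℚ))) ⟩
    r *ₗ x +ᴹ ((ℚ.- 1ℚ) ℚ.* r) *ₗ y ≈⟨ +ᴹ-congˡ (*ₗ-assoc (ℚ.- 1ℚ) r y) ⟩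
    r *ₗ x +ᴹ (ℚ.- 1ℚ) *ₗ r *ₗ y   ≈⟨ +ᴹ-congˡ (-ᴹ≈-1*ₗ (r *ₗ y)) ⟨
    r *ₗ x ⊖ r *ₗ y                ∎

  *ₗ-cancelˡ : ∀ r .{{_ : ℚ.NonZero r}} {x y} → r *ₗ x ≈ᴹ y → x ≈ᴹ (ℚ.1/ r) *ₗ y
  *ₗ-cancelˡ r {x} {y} rx≈y = begin
    x                      ≈⟨ *ₗ-identityˡ x ⟨
    1ℚ *ₗ x                ≈⟨ *ₗ-congʳ (ℚ.*-inverseˡ r) ⟨
    (ℚ.1/ r ℚ.* r) *ₗ x    ≈⟨ *ₗ-assoc (ℚ.1/ r) r x ⟩
    (ℚ.1/ r) *ₗ r *ₗ x     ≈⟨ *ₗ-congˡ rx≈y ⟩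
    (ℚ.1/ r) *ₗ y          ∎

  r*x≈0⇒r≡0∨x≈0 : ∀ r {x} → r *ₗ x ≈ᴹ 0ᴹ → r ≡ 0ℚ ⊎ x ≈ᴹ 0ᴹ
  r*x≈0⇒r≡0∨x≈0 r rx≈0 with r ℚ.≟ 0ℚ
  ... | yes r≡0 = inj₁ r≡0
  ... | no  r≢0 = inj₂ (≈ᴹ-trans (*ₗ-cancelˡ r {{ℚ.≢-nonZero r≢0}} rx≈0) (*ₗ-zeroʳ _))

  lin-cong : ∀ {n} {c d : Vector ℚ n} {v w : Vector Carrierᴹ n} →
             (∀ i → c i ≡ d i) → (∀ i → v i ≈ᴹ w i) → lin c v ≈ᴹ lin d w
  lin-cong c≡d v≈w = sum-cong-≋ λ i → *ₗ-cong (c≡d i) (v≈w i)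

  lin-+ : ∀ {n} (c d : Vector ℚ n) v → lin (λ i → c i ℚ.+ d i) v ≈ᴹ lin c v +ᴹ lin d v
  lin-+ c d v = ≈ᴹ-trans (sum-cong-≋ λ i → *ₗ-distribʳ (v i) (c i) (d i))
    (∑-distrib-+ (λ i → c i *ₗ v i) (λ i → d i *ₗ v i))

  lin-* : ∀ {n} r (c : Vector ℚ n) v → lin (λ i → r ℚ.* c i) v ≈ᴹ r *ₗ lin c v
  lin-* {zero}  r c v = ≈ᴹ-sym (*ₗ-zeroʳ r)
  lin-* {suc n} r c v = ≈ᴹ-trans
    (+ᴹ-cong (*ₗ-assoc r (c zero) (v zero)) (lin-* r (c ∘ suc) (v ∘ suc)))
    (≈ᴹ-sym (*ₗ-distribˡ r _ _))

  lin-zero : ∀ {n} (c : Vector ℚ n) v → (∀ i → c i ≡ 0ℚ) → lin c v ≈ᴹ 0ᴹ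
  lin-zero {zero}  c v c≡0 = ≈ᴹ-refl
  lin-zero {suc n} c v c≡0 = ≈ᴹ-trans
    (+ᴹ-cong (≈ᴹ-trans (*ₗ-congʳ (c≡0 zero)) (*ₗ-zeroˡ _)) (lin-zero (c ∘ suc) (v ∘ suc) (c≡0 ∘ suc)))
    (+ᴹ-identityˡ 0ᴹ)

  lin-homo : ∀ {n} g (c : Vector ℚ n) v → ⟦ g ⟧ (lin c v) ≈ᴹ lin c (⟦ g ⟧ ∘ v)
  lin-homo {zero}  g c v = GL.0ᴹ-homo g
  lin-homo {suc n} g c v = ≈ᴹ-trans (GL.+ᴹ-homo g _ _)
    (+ᴹ-cong (GL.*ₗ-homo g (c zero) (v zero)) (lin-homo g (c ∘ suc) (v ∘ suc)))

  ⊖-homo : ∀ g x y → ⟦ g ⟧ (x ⊖ y) ≈ᴹ ⟦ g ⟧ x ⊖ ⟦ g ⟧ y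
  ⊖-homo g x y = ≈ᴹ-trans (GL.+ᴹ-homo g x (-ᴹ y)) (+ᴹ-congˡ (GL.-ᴹ-homo g y))

  Span-resp : ∀ {n} {X : Vector Carrierᴹ n} {x y} → x ≈ᴹ y → Span X x → Span X y
  Span-resp x≈y (c , x≈) = c , ≈ᴹ-trans (≈ᴹ-sym x≈y) x≈

  Span-+ : ∀ {n} {X : Vector Carrierᴹ n} {x y} → Span X x → Span X y → Span X (x +ᴹ y)
  Span-+ {X = X} (c , x≈) (d , y≈) = _ , ≈ᴹ-trans (+ᴹ-cong x≈ y≈) (≈ᴹ-sym (lin-+ c d X))

  Span-generator : ∀ {n} (X : Vector Carrierᴹ n) i → Span X (X i)
  Span-generator X zero = (1ℚ ∷ const 0ℚ) , ≈ᴹ-sym (≈ᴹ-trans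
    (+ᴹ-cong (*ₗ-identityˡ (X zero)) (lin-zero (const 0ℚ) (X ∘ suc) (λ _ → refl)))
    (+ᴹ-identityʳ (X zero)))
  Span-generator X (suc i) =
    let (c , Xi≈) = Span-generator (X ∘ suc) i
    in (0ℚ ∷ c) , ≈ᴹ-trans Xi≈ (≈ᴹ-sym (≈ᴹ-trans (+ᴹ-congʳ (*ₗ-zeroˡ (X zero))) (+ᴹ-identityˡ _)))

  -- Freeness rests on this: by linearity, an element that fixes a tuple lies in the pointwise
  -- stabilizer of its span.
  fixes-Span : ∀ {n} g (X : Vector Carrierᴹ n) → (∀ i → ⟦ g ⟧ (X i) ≈ᴹ X i) →
               ∀ {w} → Span X w → ⟦ g ⟧ w ≈ᴹ w
  fixes-Span g X gX≈X {w} (c , w≈) = begin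
    ⟦ g ⟧ w               ≈⟨ GL.⟦⟧-cong g w≈ ⟩
    ⟦ g ⟧ (lin c X)       ≈⟨ lin-homo g c X ⟩
    lin c (⟦ g ⟧ ∘ X)     ≈⟨ lin-cong (λ _ → refl) gX≈X ⟩
    lin c X               ≈⟨ w≈ ⟨
    w                     ∎

  -- The same subspace as `Span {1} (const e)`, but with a bare scalar as coefficient, so that no
  -- one-term sum has to be simplified.
  Line : Carrierᴹ → Pred Carrierᴹ 0ℓ
  Line e w = ∃[ c ] w ≈ᴹ c *ₗ e

  module _ {e : Carrierᴹ} where
    Line-resp : ∀ {x y} → x ≈ᴹ y → Line e x → Line e y
    Line-resp x≈y (c , x≈) = c , ≈ᴹ-trans (≈ᴹ-sym x≈y) x≈

    Line-+ : ∀ {x y} → Line e x → Line e y → Line e (x +ᴹ y)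
    Line-+ (c , x≈) (d , y≈) = c ℚ.+ d , ≈ᴹ-trans (+ᴹ-cong x≈ y≈) (≈ᴹ-sym (*ₗ-distribʳ e c d))

    Line-neg : ∀ {x} → Line e x → Line e (-ᴹ x)
    Line-neg (c , x≈) = ℚ.- c , ≈ᴹ-trans (-ᴹ‿cong x≈) (≈ᴹ-sym (*ₗ-negˡ c e))

    Line-0 : Line e 0ᴹ
    Line-0 = 0ℚ , ≈ᴹ-sym (*ₗ-zeroˡ e)

    Line-self : Line e e
    Line-self = 1ℚ , ≈ᴹ-sym (*ₗ-identityˡ e)

    Line-image : ∀ g → Line e (⟦ g ⟧ e) → ∀ {x} → Line e x → Line e (⟦ g ⟧ x)
    Line-image g (d , ge≈) {x} (c , x≈) = c ℚ.* d , (begin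
      ⟦ g ⟧ x           ≈⟨ GL.⟦⟧-cong g x≈ ⟩
      ⟦ g ⟧ (c *ₗ e)    ≈⟨ GL.*ₗ-homo g c e ⟩
      c *ₗ ⟦ g ⟧ e      ≈⟨ *ₗ-congˡ ge≈ ⟩
      c *ₗ d *ₗ e       ≈⟨ *ₗ-assoc c d e ⟨
      (c ℚ.* d) *ₗ e    ∎)

  Span≐Line : ∀ e → Span {1} (const e) ≐ Line e
  Span≐Line e = (λ (c , w≈) → c zero , ≈ᴹ-trans w≈ (+ᴹ-identityʳ _))
              , (λ (c , w≈) → const c , ≈ᴹ-trans w≈ (≈ᴹ-sym (+ᴹ-identityʳ _)))

  -- The operator g - 1, whose iterates `IsUnipotent` requires to vanish eventually.
  Δ : GL → Carrierᴹ → Carrierᴹ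
  Δ g x = ⟦ g ⟧ x ⊖ x

  Δ-cong : ∀ g {x y} → x ≈ᴹ y → Δ g x ≈ᴹ Δ g y
  Δ-cong g x≈y = ⊖-cong (GL.⟦⟧-cong g x≈y) x≈y

  Δ-* : ∀ g r x → Δ g (r *ₗ x) ≈ᴹ r *ₗ Δ g x
  Δ-* g r x = ≈ᴹ-trans (+ᴹ-congʳ (GL.*ₗ-homo g r x)) (≈ᴹ-sym (*ₗ-distribˡ-⊖ r (⟦ g ⟧ x) x))

-- The form in orthogonal coordinates, and SO(V) as a subgroup of GL(V).

module QuadraticSpaceProperties {p : ℕ} (Q : QuadraticSpace p) where
  open QuadraticSpace Q
  open Geometry Q
  open LinearAlgebraProperties V
  open GL using (⟦_⟧)
  open ≡-Reasoning

  ⟪⟫-*ʳ : ∀ r x y → ⟪ x , r *ₗ y ⟫ ≡ r ℚ.* ⟪ x , y ⟫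
  ⟪⟫-*ʳ r x y = trans (⟪⟫-sym x (r *ₗ y)) (trans (⟪⟫-* r y x) (cong (r ℚ.*_) (⟪⟫-sym y x)))

  ⟪⟫-zeroˡ : ∀ y → ⟪ 0ᴹ , y ⟫ ≡ 0ℚ
  ⟪⟫-zeroˡ y = trans (⟪⟫-cong (≈ᴹ-sym (*ₗ-zeroˡ 0ᴹ)) ≈ᴹ-refl) (trans (⟪⟫-* 0ℚ 0ᴹ y) (ℚ.*-zeroˡ ⟪ 0ᴹ , y ⟫))

  ⟪⟫-⊖ : ∀ x y z → ⟪ x ⊖ y , z ⟫ ℚ.+ ⟪ y , z ⟫ ≡ ⟪ x , z ⟫
  ⟪⟫-⊖ x y z = trans (sym (⟪⟫-+ (x ⊖ y) y z)) (⟪⟫-cong (⊖-+ᴹ x y) ≈ᴹ-refl)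

  ⟪⟫≡⇒⟪⊖⟫≡0 : ∀ {x y z} → ⟪ x , z ⟫ ≡ ⟪ y , z ⟫ → ⟪ x ⊖ y , z ⟫ ≡ 0ℚ
  ⟪⟫≡⇒⟪⊖⟫≡0 {x} {y} {z} xz≡yz = ℚ-Group.∙-cancelʳ ⟪ y , z ⟫ _ _
    (trans (⟪⟫-⊖ x y z) (trans xz≡yz (sym (ℚ.+-identityˡ _))))

  ⟪⊖⟫≡0⇒⟪⟫≡ : ∀ {x y z} → ⟪ x ⊖ y , z ⟫ ≡ 0ℚ → ⟪ x , z ⟫ ≡ ⟪ y , z ⟫
  ⟪⊖⟫≡0⇒⟪⟫≡ {x} {y} {z} eq =
    trans (sym (⟪⟫-⊖ x y z)) (trans (cong (ℚ._+ ⟪ y , z ⟫) eq) (ℚ.+-identityˡ _))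

  ⟪⟫-lin : ∀ {n} (c : Vector ℚ n) v y → ⟪ lin c v , y ⟫ ≡ ℚ-Sum.sum (λ i → c i ℚ.* ⟪ v i , y ⟫)
  ⟪⟫-lin {zero}  c v y = ⟪⟫-zeroˡ y
  ⟪⟫-lin {suc n} c v y = trans (⟪⟫-+ _ _ y)
    (cong₂ ℚ._+_ (⟪⟫-* (c zero) (v zero) y) (⟪⟫-lin (c ∘ suc) (v ∘ suc) y))

  private
    e = orthogonalBasis
    top = fromℕ p

  ⟪lin,orthogonal⟫ : ∀ c i → ⟪ lin c e , e i ⟫ ≡ c i ℚ.* ⟪ e i , e i ⟫
  ⟪lin,orthogonal⟫ c i = trans (⟪⟫-lin c e (e i)) (sum-single _ i λ k i≢k →
    trans (cong (c k ℚ.*_) (orthogonal k i (i≢k ∘ sym))) (ℚ.*-zeroʳ (c k)))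

  ⟪lin,lin⟫ : ∀ c → ⟪ lin c e , lin c e ⟫ ≡ ℚ-Sum.sum (λ i → c i ℚ.* c i ℚ.* ⟪ e i , e i ⟫)
  ⟪lin,lin⟫ c = trans (⟪⟫-lin c e (lin c e)) (ℚ-Sum.sum-cong-≗ λ i → begin
    c i ℚ.* ⟪ e i , lin c e ⟫            ≡⟨ cong (c i ℚ.*_) (⟪⟫-sym (e i) (lin c e)) ⟩
    c i ℚ.* ⟪ lin c e , e i ⟫            ≡⟨ cong (c i ℚ.*_) (⟪lin,orthogonal⟫ c i) ⟩
    c i ℚ.* (c i ℚ.* ⟪ e i , e i ⟫)      ≡⟨ ℚ.*-assoc (c i) (c i) _ ⟨
    c i ℚ.* c i ℚ.* ⟪ e i , e i ⟫        ∎)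

  -- In the sum of the c_i² (e_i, e_i) the only possibly negative term is the last, and it is killed
  -- by `ctop≡0`. The sum being 0, all terms vanish, and (e_i, e_i) > 0 then gives c_i = 0.
  definite-hyperplane : ∀ c → c top ≡ 0ℚ → ⟪ lin c e , lin c e ⟫ ≡ 0ℚ → lin c e ≈ᴹ 0ᴹ
  definite-hyperplane c ctop≡0 isotropic = lin-zero c e coefficient≡0
    where
    term : Vector ℚ (suc p)
    term i = c i ℚ.* c i ℚ.* ⟪ e i , e i ⟫

    0≤term : ∀ i → 0ℚ ℚ.≤ term i
    0≤term i with view i
    ... | ‵fromℕ = ℚ.≤-reflexive (sym (trans (cong (ℚ._* ⟪ e top , e top ⟫)
                     (trans (cong (ℚ._* c top) ctop≡0) (ℚ.*-zeroˡ (c top)))) (ℚ.*-zeroˡ ⟪ e top , e top ⟫)))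
    ... | ‵inject₁ j = ℚ.nonNegative⁻¹ _
                         {{ℚ.nonNeg*nonNeg⇒nonNeg (c i ℚ.* c i) {{ℚ.nonNegative (p²≥0 (c i))}}
                             ⟪ e i , e i ⟫ {{ℚ.nonNegative (ℚ.<⇒≤ (positive j))}}}}

    term≡0 : ∀ i → term i ≡ 0ℚ
    term≡0 = sum≡0⇒term≡0 term 0≤term (trans (sym (⟪lin,lin⟫ c)) isotropic)

    coefficient≡0 : ∀ i → c i ≡ 0ℚ
    coefficient≡0 i with view i
    ... | ‵fromℕ = ctop≡0
    ... | ‵inject₁ j with p*q≡0⇒p≡0∨q≡0 (c i ℚ.* c i) ⟪ e i , e i ⟫ (term≡0 i)
    ...   | inj₂ q≡0 = contradiction (sym q≡0) (ℚ.<⇒≢ (positive j))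
    ...   | inj₁ cc≡0 with p*q≡0⇒p≡0∨q≡0 (c i) (c i) cc≡0
    ...     | inj₁ c≡0 = c≡0
    ...     | inj₂ c≡0 = c≡0

  SO-resp : ∀ {f g} → (∀ v → ⟦ f ⟧ v ≈ᴹ ⟦ g ⟧ v) → SO f → SO g
  SO-resp f≈g (isometry , det) =
      (λ x y → trans (⟪⟫-cong (≈ᴹ-sym (f≈g x)) (≈ᴹ-sym (f≈g y))) (isometry x y))
    , (λ ω alt v → trans (Determinant.IsAlternatingForm.ω-cong alt (λ i → ≈ᴹ-sym (f≈g (v i)))) (det ω alt v))

  SO-isSubgroup : IsSubgroup GLᴳ SO
  SO-isSubgroup = record
    { resp = λ {f} {g} → SO-resp {f} {g}
    ; ε-closed = (λ x y → refl) , (λ ω alt v → sym (ℚ.*-identityˡ _))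
    ; ∙-closed = λ { {f} {g} (isoᶠ , detᶠ) (isoᵍ , detᵍ) →
          (λ x y → trans (isoᶠ _ _) (isoᵍ x y))
        , (λ ω alt v → trans (detᶠ ω alt (⟦ g ⟧ ∘ v)) (trans (ℚ.*-identityˡ _) (detᵍ ω alt v))) }
    ; ⁻¹-closed = λ { {g} (iso , det) →
          (λ x y → trans (sym (iso _ _)) (⟪⟫-cong (GL.inv-section g x) (GL.inv-section g y)))
        -- Since g has determinant 1, ω(g⁻¹v) = ω(g(g⁻¹v)) = ω(v).
        , (λ ω alt v → trans (sym (ℚ.*-identityˡ _)) (trans (sym (det ω alt (GL.inv g ∘ v)))
            (trans (Determinant.IsAlternatingForm.ω-cong alt (λ i → GL.inv-section g (v i)))
              (sym (ℚ.*-identityˡ _))))) }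
    }

-- An isotropic line ℓ = ℚv and the isotropic vectors of ℓ^⊥.

module Cusp {p : ℕ} (Q : QuadraticSpace p) (v : QuadraticSpace.Carrierᴹ Q)
            (v≉0 : QuadraticSpace._≉ᴹ_ Q v (QuadraticSpace.0ᴹ Q))
            (⟪v,v⟫≡0 : QuadraticSpace.⟪_,_⟫ Q v v ≡ 0ℚ)
            (l : Pred (QuadraticSpace.Carrierᴹ Q) 0ℓ)
            (l≐ : l ≐ QuadraticSpace.Span Q {1} (const v)) where
  open QuadraticSpace Q
  open Geometry Q
  open LinearAlgebraProperties V
  open QuadraticSpaceProperties Q
  open GL using (⟦_⟧)
  open SetoidReasoning ≈ᴹ-setoid
  private
    module SO = IsSubgroup SO-isSubgroup

  l⊆Line : ∀ {x} → l x → Line v x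
  l⊆Line = proj₁ (Span≐Line v) ∘ proj₁ l≐

  Line⊆l : ∀ {x} → Line v x → l x
  Line⊆l = proj₂ l≐ ∘ proj₂ (Span≐Line v)

  Line-⊥ : ∀ {x y} → ⟪ x , v ⟫ ≡ 0ℚ → Line v y → ⟪ x , y ⟫ ≡ 0ℚ
  Line-⊥ {x} x⊥v (c , y≈) = trans (⟪⟫-cong ≈ᴹ-refl y≈)
    (trans (⟪⟫-*ʳ c x v) (trans (cong (c ℚ.*_) x⊥v) (ℚ.*-zeroʳ c)))

  -- The negative coordinate a of v is nonzero, and with b that of x the vector a x − b v is an
  -- isotropic vector in the positive definite hyperplane, hence zero.
  isotropic-⊥⇒Line : ∀ {x} → ⟪ x , v ⟫ ≡ 0ℚ → ⟪ x , x ⟫ ≡ 0ℚ → Line v x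
  isotropic-⊥⇒Line {x} x⊥v x⊥x with IsBasis.spanning isOrthogonalBasis v | IsBasis.spanning isOrthogonalBasis x
  ... | a , v≈ | b , x≈ = ℚ.1/ a₀ ℚ.* b₀ , ≈ᴹ-trans (*ₗ-cancelˡ a₀ a₀x≈b₀v) (≈ᴹ-sym (*ₗ-assoc (ℚ.1/ a₀) b₀ v))
    where
    a₀ = a (fromℕ p)
    b₀ = b (fromℕ p)
    w = orthogonalBasis

    -- Otherwise `v` itself would be a nonzero isotropic vector of the positive definite hyperplane.
    a₀≢0 : a₀ ≢ 0ℚ
    a₀≢0 a₀≡0 = v≉0 (≈ᴹ-trans v≈ (definite-hyperplane a a₀≡0
      (trans (⟪⟫-cong (≈ᴹ-sym v≈) (≈ᴹ-sym v≈)) ⟪v,v⟫≡0)))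

    instance _ = ℚ.≢-nonZero a₀≢0

    y = a₀ *ₗ x +ᴹ (ℚ.- b₀) *ₗ v
    d = λ i → a₀ ℚ.* b i ℚ.+ (ℚ.- b₀) ℚ.* a i

    y≈ : y ≈ᴹ lin d w
    y≈ = ≈ᴹ-sym (≈ᴹ-trans (lin-+ (λ i → a₀ ℚ.* b i) (λ i → (ℚ.- b₀) ℚ.* a i) w) (+ᴹ-cong
      (≈ᴹ-trans (lin-* a₀ b w) (*ₗ-congˡ (≈ᴹ-sym x≈)))
      (≈ᴹ-trans (lin-* (ℚ.- b₀) a w) (*ₗ-congˡ (≈ᴹ-sym v≈)))))

    d₀≡0 : d (fromℕ p) ≡ 0ℚ
    d₀≡0 = solve 2 (λ r s → r :* s :+ (:- s) :* r := con 0ℚ) refl a₀ b₀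
      where
      open ℚ-Solver.+-*-Solver

    ⟪y,-⟫≡0 : ∀ {z} → ⟪ x , z ⟫ ≡ 0ℚ → ⟪ v , z ⟫ ≡ 0ℚ → ⟪ y , z ⟫ ≡ 0ℚ
    ⟪y,-⟫≡0 {z} x⊥z v⊥z = trans (⟪⟫-+ _ _ z) (cong₂ ℚ._+_
      (trans (⟪⟫-* a₀ x z) (trans (cong (a₀ ℚ.*_) x⊥z) (ℚ.*-zeroʳ a₀)))
      (trans (⟪⟫-* (ℚ.- b₀) v z) (trans (cong ((ℚ.- b₀) ℚ.*_) v⊥z) (ℚ.*-zeroʳ (ℚ.- b₀)))))

    ⟪y,y⟫≡0 : ⟪ y , y ⟫ ≡ 0ℚ
    ⟪y,y⟫≡0 = ⟪y,-⟫≡0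
      (trans (⟪⟫-sym x y) (⟪y,-⟫≡0 x⊥x (trans (⟪⟫-sym v x) x⊥v)))
      (trans (⟪⟫-sym v y) (⟪y,-⟫≡0 x⊥v ⟪v,v⟫≡0))

    y≈0 : y ≈ᴹ 0ᴹ
    y≈0 = ≈ᴹ-trans y≈ (definite-hyperplane d d₀≡0 (trans (⟪⟫-cong (≈ᴹ-sym y≈) (≈ᴹ-sym y≈)) ⟪y,y⟫≡0))

    a₀x≈b₀v : a₀ *ₗ x ≈ᴹ b₀ *ₗ v
    a₀x≈b₀v = x⊖y≈0⇒x≈y (≈ᴹ-trans (+ᴹ-congˡ (≈ᴹ-sym (*ₗ-negˡ b₀ v))) y≈0)

  -- The group of isometries acting trivially on ℓ and on ℓ^⊥/ℓ.

  isometry-inv : ∀ g → SO g → ∀ x y → ⟪ GL.inv g x , y ⟫ ≡ ⟪ x , ⟦ g ⟧ y ⟫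
  isometry-inv g (isometry , _) x y =
    trans (sym (isometry _ _)) (⟪⟫-cong (GL.inv-section g x) ≈ᴹ-refl)

  -- The concrete description of N: `fixes` concerns ℓ and `graded` concerns ℓ^⊥/ℓ. Triviality on
  -- V/ℓ^⊥ follows by duality and is the content of `⟪-,v⟫-invariant`.
  record ActsTriviallyOnFlag (g : GL) : Set where
    field
      isSO   : SO g
      fixes  : ⟦ g ⟧ v ≈ᴹ v
      graded : ∀ x → ⟪ x , v ⟫ ≡ 0ℚ → Line v (Δ g x)

    ⟪-,v⟫-invariant : ∀ x → ⟪ ⟦ g ⟧ x , v ⟫ ≡ ⟪ x , v ⟫
    ⟪-,v⟫-invariant x = trans (⟪⟫-cong ≈ᴹ-refl (≈ᴹ-sym fixes)) (proj₁ isSO x v)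

    fixes-Line : ∀ {x} → Line v x → ⟦ g ⟧ x ≈ᴹ x
    fixes-Line (c , x≈) = ≈ᴹ-trans (GL.⟦⟧-cong g x≈)
      (≈ᴹ-trans (GL.*ₗ-homo g c v) (≈ᴹ-trans (*ₗ-congˡ fixes) (≈ᴹ-sym x≈)))

    Line-preserved : ∀ {x} → Line v x → Line v (⟦ g ⟧ x)
    Line-preserved x∈ = Line-resp (≈ᴹ-sym (fixes-Line x∈)) x∈

  open ActsTriviallyOnFlag

  flag-isSubgroup : IsSubgroup GLᴳ ActsTriviallyOnFlag
  flag-isSubgroup = record
    { resp = λ {f} {g} f≈g F → record
      { isSO   = SO.resp {f} {g} f≈g (isSO F)
      ; fixes  = ≈ᴹ-trans (≈ᴹ-sym (f≈g v)) (fixes F)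
      ; graded = λ x x⊥v → Line-resp (+ᴹ-congʳ (f≈g x)) (graded F x x⊥v) }
    ; ε-closed = record
      { isSO   = SO.ε-closed
      ; fixes  = ≈ᴹ-refl
      ; graded = λ x _ → Line-resp (≈ᴹ-sym (-ᴹ‿inverseʳ x)) Line-0 }
    ; ∙-closed = λ {f} {g} F G → record
      { isSO   = SO.∙-closed {f} {g} (isSO F) (isSO G)
      ; fixes  = ≈ᴹ-trans (GL.⟦⟧-cong f (fixes G)) (fixes F)
      -- fg - 1 = (f - 1)g + (g - 1), where g preserves ℓ^⊥.
      ; graded = λ x x⊥v → Line-resp (⊖-telescope (⟦ f ⟧ (⟦ g ⟧ x)) (⟦ g ⟧ x) x)
          (Line-+ (graded F (⟦ g ⟧ x) (trans (⟪-,v⟫-invariant G x) x⊥v)) (graded G x x⊥v)) }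
    ; ⁻¹-closed = λ {g} G → record
      { isSO   = SO.⁻¹-closed {g} (isSO G)
      ; fixes  = GL.inv-unique g (fixes G)
      -- g⁻¹ - 1 = -(g - 1)g⁻¹, where g⁻¹ preserves ℓ^⊥ because it is the adjoint of g and gv = v.
      ; graded = λ x x⊥v → Line-resp
          (≈ᴹ-trans (⊖-swap (⟦ g ⟧ (GL.inv g x)) (GL.inv g x)) (+ᴹ-congˡ (-ᴹ‿cong (GL.inv-section g x))))
          (Line-neg (graded G (GL.inv g x) (trans (isometry-inv g (isSO G) x v)
            (trans (⟪⟫-cong ≈ᴹ-refl (fixes G)) x⊥v)))) }
    }

  flag⇒Parabolic : ∀ {g} → ActsTriviallyOnFlag g → Parabolic l g
  flag⇒Parabolic {g} G = isSO G
    , (λ { (u , u∈l , w≈) → Line⊆l (Line-resp (≈ᴹ-sym w≈) (Line-preserved G (l⊆Line u∈l))) })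
    , (λ {w} w∈l → w , w∈l , ≈ᴹ-sym (fixes-Line G (l⊆Line w∈l)))

  Parabolic-image : ∀ {g} → Parabolic l g → Line v (⟦ g ⟧ v)
  Parabolic-image (_ , gl⊆l , _) = l⊆Line (gl⊆l (v , Line⊆l Line-self , ≈ᴹ-refl))

  Parabolic-inv : ∀ {g} → Parabolic l g → Line v (GL.inv g v)
  Parabolic-inv {g} (_ , _ , l⊆gl) =
    let (u , u∈l , v≈gu) = l⊆gl (Line⊆l Line-self)
    in Line-resp (≈ᴹ-sym (GL.inv-unique g (≈ᴹ-sym v≈gu))) (l⊆Line u∈l)

  flag-isNormal : IsNormalSubgroupOf GLᴳ ActsTriviallyOnFlag (Parabolic l)
  flag-isNormal = record
    { isSubgroup = flag-isSubgroup
    ; H⊆K = λ {g} → flag⇒Parabolic {g}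
    ; conjugate = λ {x} {y} P Y → record
      { isSO   = SO.∙-closed {x GL∙ y} {x GL⁻¹} (SO.∙-closed {x} {y} (proj₁ P) (isSO Y)) (SO.⁻¹-closed {x} (proj₁ P))
      -- An element x of the parabolic may rescale `v`, but x⁻¹v stays in ℓ, where y is the
      -- identity.
      ; fixes  = ≈ᴹ-trans (GL.⟦⟧-cong x (fixes-Line Y (Parabolic-inv {x} P))) (GL.inv-section x v)
      -- xyx⁻¹ - 1 = x(y - 1)x⁻¹: x⁻¹ preserves ℓ^⊥ since xv is in ℓ, then y - 1 maps into ℓ, which
      -- x preserves.
      ; graded = λ w w⊥v → Line-resp
          (≈ᴹ-trans (⊖-homo x (⟦ y ⟧ (GL.inv x w)) (GL.inv x w)) (+ᴹ-congˡ (-ᴹ‿cong (GL.inv-section x w))))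
          (Line-image x (Parabolic-image {x} P)
            (graded Y (GL.inv x w) (trans (isometry-inv x (proj₁ P) w v) (Line-⊥ w⊥v (Parabolic-image {x} P))))) }
    }
    where
    _GL∙_ = Group._∙_ GLᴳ
    _GL⁻¹ = Group._⁻¹ GLᴳ

  -- The exponent 3 is the length of the flag: g - 1 maps V into ℓ^⊥, ℓ^⊥ into ℓ, and ℓ to 0.
  flag⇒unipotent : ∀ {g} → ActsTriviallyOnFlag g → IsUnipotent g
  flag⇒unipotent {g} G = 3 , λ x → x≈y⇒x⊖y≈0
    (fixes-Line G (graded G (Δ g x) (⟪⟫≡⇒⟪⊖⟫≡0 (⟪-,v⟫-invariant G x))))

  -- Unipotent elements of the parabolic act trivially on ℓ and on ℓ^⊥/ℓ.

  -- pow is abstract because the iterates of g − 1 in IsUnipotent are local to that definition.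
  module Descent {g : GL} (P : Parabolic l g) (pow : ℕ → Carrierᴹ → Carrierᴹ)
                 (pow-zero : ∀ x → pow zero x ≈ᴹ x)
                 (pow-suc : ∀ m x → pow (suc m) x ≈ᴹ Δ g (pow m x)) where

    isometry = proj₁ (proj₁ P)

    pow-Line : ∀ m → Line v (pow m v)
    pow-Line zero    = Line-resp (≈ᴹ-sym (pow-zero v)) Line-self
    pow-Line (suc m) = Line-resp (≈ᴹ-sym (pow-suc m v))
      (Line-+ (Line-image g (Parabolic-image {g} P) (pow-Line m)) (Line-neg (pow-Line m)))

    -- On ℓ the operator g - 1 is a scalar, and a nilpotent scalar is 0. As a descent: if (g - 1)^m
    -- v = cv, then c(g - 1)v = 0, so either gv = v or c = 0 and the exponent drops. At exponent 0
    -- this would give v = 0.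
    pow≈0⇒fixes : ∀ m → pow m v ≈ᴹ 0ᴹ → ⟦ g ⟧ v ≈ᴹ v
    pow≈0⇒fixes zero    v≈0 = contradiction (≈ᴹ-trans (≈ᴹ-sym (pow-zero v)) v≈0) v≉0
    pow≈0⇒fixes (suc m) pow≈0 with pow-Line m
    ... | c , pow≈cv with r*x≈0⇒r≡0∨x≈0 c (≈ᴹ-trans (≈ᴹ-sym (≈ᴹ-trans (pow-suc m v)
                            (≈ᴹ-trans (Δ-cong g pow≈cv) (Δ-* g c v)))) pow≈0)
    ...   | inj₁ c≡0 = pow≈0⇒fixes m (≈ᴹ-trans pow≈cv (≈ᴹ-trans (*ₗ-congʳ c≡0) (*ₗ-zeroˡ v)))
    ...   | inj₂ Δv≈0 = x⊖y≈0⇒x≈y Δv≈0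

    module _ (gv≈v : ⟦ g ⟧ v ≈ᴹ v) where

      ⟪g-,v⟫≡ : ∀ x → ⟪ ⟦ g ⟧ x , v ⟫ ≡ ⟪ x , v ⟫
      ⟪g-,v⟫≡ x = trans (⟪⟫-cong ≈ᴹ-refl (≈ᴹ-sym gv≈v)) (isometry x v)

      -- With w = gy − y and gw − w ∈ ℓ, (w, w) = (gy, w) − (y, w) = (gy, w) − (gy, gw) = 0.
      Δ²∈Line⇒Δ∈Line : ∀ {y} → ⟪ y , v ⟫ ≡ 0ℚ → Line v (Δ g (Δ g y)) → Line v (Δ g y)
      Δ²∈Line⇒Δ∈Line {y} y⊥v Δw∈ = isotropic-⊥⇒Line (⟪⟫≡⇒⟪⊖⟫≡0 (⟪g-,v⟫≡ y)) (⟪⟫≡⇒⟪⊖⟫≡0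
        (trans (⟪⟫-sym (⟦ g ⟧ y) w) (trans (sym (⟪⊖⟫≡0⇒⟪⟫≡ Δw⊥gy))
          (trans (isometry w y) (⟪⟫-sym w y)))))
        where
        w = Δ g y
        Δw⊥gy : ⟪ Δ g w , ⟦ g ⟧ y ⟫ ≡ 0ℚ
        Δw⊥gy = trans (⟪⟫-sym (Δ g w) (⟦ g ⟧ y)) (Line-⊥ (trans (⟪g-,v⟫≡ y) y⊥v) Δw∈)

      pow-⊥ : ∀ m {x} → ⟪ x , v ⟫ ≡ 0ℚ → ⟪ pow m x , v ⟫ ≡ 0ℚ
      pow-⊥ zero    {x} x⊥v = trans (⟪⟫-cong (pow-zero x) ≈ᴹ-refl) x⊥v
      pow-⊥ (suc m) {x} x⊥v = trans (⟪⟫-cong (pow-suc m x) ≈ᴹ-refl) (⟪⟫≡⇒⟪⊖⟫≡0 (⟪g-,v⟫≡ (pow m x)))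

      -- Nilpotence of g - 1 on the anisotropic space ℓ^⊥/ℓ is lowered to exponent 1:
      -- `Δ²∈Line⇒Δ∈Line`, applied to y = (g - 1)^m x, replaces exponent m + 2 by m + 1.
      pow∈Line⇒Δ∈Line : ∀ m {x} → ⟪ x , v ⟫ ≡ 0ℚ → Line v (pow m x) → Line v (Δ g x)
      -- At exponent 0 the vector x itself is in ℓ, which g stabilizes.
      pow∈Line⇒Δ∈Line zero {x} x⊥v x∈ =
        let x∈′ = Line-resp (pow-zero x) x∈
        in Line-+ (Line-image g (Parabolic-image {g} P) x∈′) (Line-neg x∈′)
      pow∈Line⇒Δ∈Line (suc zero) {x} x⊥v pow∈ =
        Line-resp (≈ᴹ-trans (pow-suc 0 x) (Δ-cong g (pow-zero x))) pow∈
      pow∈Line⇒Δ∈Line (suc (suc m)) {x} x⊥v pow∈ = pow∈Line⇒Δ∈Line (suc m) x⊥v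
        (Line-resp (≈ᴹ-sym (pow-suc m x)) (Δ²∈Line⇒Δ∈Line (pow-⊥ m x⊥v)
          (Line-resp (≈ᴹ-trans (pow-suc (suc m) x) (Δ-cong g (pow-suc m x))) pow∈)))

    nilpotent⇒flag : (∃[ m ] ∀ x → pow m x ≈ᴹ 0ᴹ) → ActsTriviallyOnFlag g
    nilpotent⇒flag (m , pow≈0) = record
      { isSO   = proj₁ P
      ; fixes  = gv≈v
      ; graded = λ x x⊥v → pow∈Line⇒Δ∈Line gv≈v m x⊥v (Line-resp (≈ᴹ-sym (pow≈0 x)) Line-0) }
      where gv≈v = pow≈0⇒fixes m (pow≈0 v)

  unipotent⇒flag : ∀ {g} → Parabolic l g → IsUnipotent g → ActsTriviallyOnFlag g
  -- Unification finds the iterates inside `IsUnipotent`; their two recursion equations hold by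
  -- definition.
  unipotent⇒flag {g} P = Descent.nilpotent⇒flag {g} P _ (λ _ → ≈ᴹ-refl) (λ _ _ → ≈ᴹ-refl)

  -- Identification of the unipotent radical N.

  N⇒flag : ∀ {g} → N l g → ActsTriviallyOnFlag g
  N⇒flag {g} (H , H◁P , unipotent , g∈H) =
    unipotent⇒flag {g} (IsNormalSubgroupOf.H⊆K H◁P {g} g∈H) (unipotent g∈H)

  -- The radical is a union over normal unipotent subgroups of the parabolic, so it suffices that
  -- the flag-trivial isometries form one.
  flag⇒N : ∀ {g} → ActsTriviallyOnFlag g → N l g
  flag⇒N G = ActsTriviallyOnFlag , flag-isNormal , flag⇒unipotent , G

  -- A union of subgroups is not evidently closed under products; closure is transported from the
  -- flag-trivial isometries.
  N-isSubgroup : IsSubgroup GLᴳ (N l)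
  N-isSubgroup = record
    { resp      = λ f≈g → flag⇒N ∘ F.resp f≈g ∘ N⇒flag
    ; ε-closed  = flag⇒N F.ε-closed
    ; ∙-closed  = λ f∈N g∈N → flag⇒N (F.∙-closed (N⇒flag f∈N) (N⇒flag g∈N))
    ; ⁻¹-closed = flag⇒N ∘ F.⁻¹-closed ∘ N⇒flag
    }
    where
    module F = IsSubgroup flag-isSubgroup

  -- The action of N on tuples with radical ℓ.

  module _ {n : ℕ} {X : Vector Carrierᴹ n} (R≐l : Radical X ≐ l) where

    Span-⊥ : ∀ {w} → Span X w → ⟪ w , v ⟫ ≡ 0ℚ
    Span-⊥ {w} w∈ = trans (⟪⟫-sym w v) (proj₂ (proj₂ R≐l (Line⊆l Line-self)) w w∈)

    Line⊆Span : ∀ {w} → Line v w → Span X w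
    Line⊆Span = proj₁ ∘ proj₂ R≐l ∘ Line⊆l

    -- gw = (gw - w) + w, and gw - w lies in ℓ, hence in span X, because w is orthogonal to the
    -- radical ℓ.
    flag-Span : ∀ {g} → ActsTriviallyOnFlag g → ∀ {w} → Span X w → Span X (⟦ g ⟧ w)
    flag-Span {g} G {w} w∈ = Span-resp {X = X} (⊖-+ᴹ (⟦ g ⟧ w) w)
      (Span-+ {X = X} (Line⊆Span (graded G w (Span-⊥ w∈))) w∈)

    Span-image : ∀ {g} → ActsTriviallyOnFlag g → Span (⟦ g ⟧ ∘ X) ≐ Span X
    Span-image {g} G = to , from
      where
      to : Span (⟦ g ⟧ ∘ X) ⊆ Span X
      to (c , w≈) = Span-resp {X = X} (≈ᴹ-sym (≈ᴹ-trans w≈ (≈ᴹ-sym (lin-homo g c X))))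
        (flag-Span G (c , ≈ᴹ-refl))

      -- Write w = g(g⁻¹w); the inverse also preserves span X.
      from : Span X ⊆ Span (⟦ g ⟧ ∘ X)
      from {w} w∈ =
        let (c , g⁻¹w≈) = flag-Span (IsSubgroup.⁻¹-closed flag-isSubgroup G) w∈
        in c , ≈ᴹ-trans (≈ᴹ-sym (GL.inv-section g w)) (≈ᴹ-trans (GL.⟦⟧-cong g g⁻¹w≈) (lin-homo g c X))

    -- The radical depends on a tuple only through its span, which g leaves unchanged.
    Radical-image : ∀ {g} → ActsTriviallyOnFlag g → Radical (⟦ g ⟧ ∘ X) ≐ l
    Radical-image G =
        (λ (u∈ , u⊥) → proj₁ R≐l (proj₁ S≐ u∈ , λ w w∈ → u⊥ w (proj₂ S≐ w∈)))
      , (λ u∈l → let (u∈ , u⊥) = proj₂ R≐l u∈l in proj₂ S≐ u∈ , λ w w∈ → u⊥ w (proj₁ S≐ w∈))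
      where S≐ = Span-image G

  module _ {n : ℕ} (β : Mat ℚ n) where

    flag-Ω : ∀ {g X} → ActsTriviallyOnFlag g → Ω β l X → Ω β l (⟦ g ⟧ ∘ X)
    flag-Ω {g} {X} G (gram , R≐l) =
        (λ i k → trans (cong (½ ℚ.*_) (proj₁ (isSO G) (X i) (X k))) (gram i k))
      , Radical-image R≐l G

    flag-Ω[] : ∀ {g X U} → ActsTriviallyOnFlag g → Ω[_] β l U X → Ω[_] β l U (⟦ g ⟧ ∘ X)
    flag-Ω[] G (X∈Ω@(_ , R≐l) , S≐U) = flag-Ω G X∈Ω
      , (proj₁ S≐U ∘ proj₁ (Span-image R≐l G))
      , (proj₂ (Span-image R≐l G) ∘ proj₂ S≐U)

  -- The arithmetic group Γ ∩ N and the free action of its quotient.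

  module _ (Γ : Pred GL (lsuc 0ℓ)) (Γ≤GL : IsSubgroup GLᴳ Γ) where
    open Group GLᴳ using (_∙_; _⁻¹; ε)
    private
      module Γ = IsSubgroup Γ≤GL
      module N = IsSubgroup N-isSubgroup

    Γ∩N-isSubgroup : IsSubgroup GLᴳ (Γ∩N Γ l)
    Γ∩N-isSubgroup = record
      { resp      = λ {f} {g} f≈g (γ , ν) → Γ.resp {f} {g} f≈g γ , N.resp {f} {g} f≈g ν
      ; ε-closed  = Γ.ε-closed , N.ε-closed
      ; ∙-closed  = λ {f} {g} (γ , ν) (γ′ , ν′) → Γ.∙-closed {f} {g} γ γ′ , N.∙-closed {f} {g} ν ν′
      ; ⁻¹-closed = λ {g} (γ , ν) → Γ.⁻¹-closed {g} γ , N.⁻¹-closed {g} ν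
      }

    private
      module Γ∩N = IsSubgroup Γ∩N-isSubgroup

    flag : ∀ {g} → Γ∩N Γ l g → ActsTriviallyOnFlag g
    flag (_ , g∈N) = N⇒flag g∈N

    -- The pointwise stabilizer of an invariant subspace is normal: for u in U = span X, x⁻¹u is
    -- again in U, so y fixes it and xyx⁻¹u = u.
    Γ-fixing-isNormal : ∀ {n} {X : Vector Carrierᴹ n} {U : Pred Carrierᴹ 0ℓ} →
                        Radical X ≐ l → U ≐ Span X →
                        IsNormalSubgroupOf GLᴳ (Γ-fixing Γ l U) (Γ∩N Γ l)
    Γ-fixing-isNormal {U = U} R≐l U≐S = record
      { isSubgroup = record
        { resp = λ {f} {g} f≈g ((_ , fix) , f∈) →
            fixing {g} (Γ∩N.resp {f} {g} f≈g f∈) λ u u∈ → ≈ᴹ-trans (≈ᴹ-sym (f≈g u)) (fix u u∈)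
        ; ε-closed = fixing {ε} Γ∩N.ε-closed λ _ _ → ≈ᴹ-refl
        ; ∙-closed = λ {f} {g} ((_ , fixᶠ) , f∈) ((_ , fixᵍ) , g∈) →
            fixing {f ∙ g} (Γ∩N.∙-closed {f} {g} f∈ g∈) λ u u∈ →
              ≈ᴹ-trans (GL.⟦⟧-cong f (fixᵍ u u∈)) (fixᶠ u u∈)
        ; ⁻¹-closed = λ {g} ((_ , fix) , g∈) →
            fixing {g ⁻¹} (Γ∩N.⁻¹-closed {g} g∈) λ u u∈ → GL.inv-unique g (fix u u∈)
        }
      ; H⊆K = proj₂
      ; conjugate = λ {x} {y} x∈ ((_ , fix) , y∈) →
          fixing {x ∙ y ∙ x ⁻¹}
            (Γ∩N.∙-closed {x ∙ y} {x ⁻¹} (Γ∩N.∙-closed {x} {y} x∈ y∈) (Γ∩N.⁻¹-closed {x} x∈))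
            λ u u∈ → ≈ᴹ-trans
              (GL.⟦⟧-cong x (fix (GL.inv x u) (proj₂ U≐S
                (flag-Span R≐l (flag (Γ∩N.⁻¹-closed {x} x∈)) (proj₁ U≐S u∈)))))
              (GL.inv-section x u)
      }
      where
      fixing : ∀ {g} → Γ∩N Γ l g → (∀ u → U u → ⟦ g ⟧ u ≈ᴹ u) → Γ-fixing Γ l U g
      fixing g∈ fix = (proj₂ g∈ , fix) , g∈

    inducesFreeAction : ∀ {n} (β : Mat ℚ n) {X : Vector Carrierᴹ n} {U : Pred Carrierᴹ 0ℓ} →
                        Radical X ≐ l → U ≐ Span X → InducesFreeAction Γ l β U
    inducesFreeAction β R≐l U≐S = record
      { isSubgroup = Γ∩N-isSubgroup
      ; isNormal = Γ-fixing-isNormal R≐l U≐S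
      ; action = record
        { _▷_ = λ (g , g∈) (Y , Y∈) → ⟦ g ⟧ ∘ Y , flag-Ω β (flag g∈) Y∈
        ; ▷-cong = λ {(g , _)} {_} {_} {(Y′ , _)} g≈g′ Y≈Y′ i →
            ≈ᴹ-trans (GL.⟦⟧-cong g (Y≈Y′ i)) (g≈g′ (Y′ i))
        ; ▷-ε = λ _ _ → ≈ᴹ-refl
        ; ▷-∙ = λ _ _ _ _ → ≈ᴹ-refl
        }
      ; induced = record
        { _▷_ = λ (g , g∈) (Y , Y∈) → ⟦ g ⟧ ∘ Y , flag-Ω[] β (flag g∈) Y∈
        -- Equality of classes means that g g′⁻¹ fixes U pointwise. The entries of g′Y′ lie in U, so
        -- gY′ = (g g′⁻¹)(g′Y′) = g′Y′.
        ; ▷-cong = λ {(g , _)} {(g′ , g′∈)} {_} {(Y′ , Y′∈)} ((_ , fix) , _) Y≈Y′ i →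
            ≈ᴹ-trans (GL.⟦⟧-cong g (≈ᴹ-trans (Y≈Y′ i) (≈ᴹ-sym (GL.inv-unique g′ ≈ᴹ-refl))))
              (fix (⟦ g′ ⟧ (Y′ i)) (proj₁ (proj₂ (flag-Ω[] β (flag g′∈) Y′∈))
                (Span-generator (⟦ g′ ⟧ ∘ Y′) i)))
        ; ▷-ε = λ _ _ → ≈ᴹ-refl
        ; ▷-∙ = λ _ _ _ _ → ≈ᴹ-refl
        }
      ; action-def = λ _ _ _ → ≈ᴹ-refl
      ; compatible = λ _ _ _ _ → ≈ᴹ-refl
      -- Being trivial in the quotient means that g ε⁻¹ fixes U pointwise. Here ε⁻¹ computes to the
      -- identity map, and g fixes span Y = U because it fixes Y.
      ; free = λ (g , g∈) (Y , (_ , S≐U)) gY≈Y →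
          let g/ε∈ = Γ∩N.∙-closed {g} {ε ⁻¹} g∈ (Γ∩N.⁻¹-closed {ε} Γ∩N.ε-closed)
          in (proj₂ g/ε∈ , λ u u∈ → fixes-Span g Y gY≈Y (proj₂ S≐U u∈)) , g/ε∈
      }

lemma3p3 :
    (p n : ℕ) → 1 ≤ n → n ≤ p →
    (Q : QuadraticSpace p) →
    let open QuadraticSpace Q
        open Geometry Q
    in
    (L : Pred Carrierᴹ 0ℓ) → IsFullLattice L → L ⊆ Dual L →
    (h : Vector Carrierᴹ n) → (∀ i → Dual L (h i)) →
    (Γ : Pred GL (lsuc 0ℓ)) → IsSubgroup GLᴳ Γ →
    IsFiniteIndexIn GLᴳ Γ (Stabilizer L) →
    IsNeat Γ →
    ActsTriviallyOnDiscriminant Γ L →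
    (Σ[ v ∈ Carrierᴹ ] v ≉ᴹ 0ᴹ × ⟪ v , v ⟫ ≡ 0ℚ) →
    (r : ℕ) (l : Fin (suc r) → Pred Carrierᴹ 0ℓ) → RepresentOrbitsOfIsotropicLines Γ l →
    (β : Mat ℚ n) → IsSymmetric β → IsPositiveSemidefinite β → HasRank β (pred n) →
    (j : Fin (suc r)) →
    (U : Pred Carrierᴹ 0ℓ) → HasDimension U n →
    (Σ[ X ∈ Vector Carrierᴹ n ] Ω β (l j) X × X ∈ L ^n+ h × U ≐ Span X) →
    InducesFreeAction Γ (l j) β U
lemma3p3 _ _ _ _ Q _ _ _ _ _ Γ Γ≤GL _ _ _ _ _ l orbits β _ _ _ j U _ (X , (_ , R≐l) , _ , U≐S) =
  -- `X` exhibits U as the span of a tuple with radical ℓ, which places U between ℓ and ℓ^⊥; a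
  -- generator `v` of ℓ comes from the orbit representatives.
  let (v , v≉0 , ⟪v,v⟫≡0 , l≐) = Geometry.RepresentOrbitsOfIsotropicLines.isotropic orbits j
  in Cusp.inducesFreeAction Q v v≉0 ⟪v,v⟫≡0 (l j) l≐ Γ Γ≤GL β R≐l U≐S
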